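{- There is an absolute constant $c>0$ such that for every integer $n$ and every $\varepsilon\in(1/\sqrt n,1)$ there is an $n$-vertex graph $G$ for which every $(1+\varepsilon)$-cut sparsifier $H$ of $G$ has at least $c\,n/\varepsilon^2$ edges, even if $H$ is not required to be a subgraph of $G$.
   Context: Graphs are undirected, possibly with positive edge weights (an unweighted graph has all edge weights equal to $1$). For a graph $G=(V,E,w)$ and $S\subset V$, $w_G(S,\bar S)$ denotes the total weight of the edges of $G$ with exactly one endpoint in $S$. A $(1+\varepsilon)$-cut sparsifier of $G$ is a positively edge-weighted graph $H$ on the same vertex set $V$ such that $(1-\varepsilon)w_G(S,\bar S)\le w_H(S,\bar S)\le(1+\varepsilon)w_G(S,\bar S)$ for every $S\subset V$. -}

module Defs where

open import Algebra.Bundles using (CommutativeMonoid)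
import Algebra.Properties.CommutativeSemigroup as CommutativeSemigroupProperties
open import Data.Bool.Base using (Bool; T; if_then_else_; _∧_; not)
open import Data.Bool.Properties using (T?)
open import Data.Fin.Base using (Fin)
open import Data.Fin.Properties using (_<?_)
open import Data.Fin.Subset using (Subset)
open import Data.Integer.Base using (+_)
open import Data.List.Base using (List; length; filter; allFin; cartesianProduct)
open import Data.Nat.Base as ℕ using (ℕ)
import Data.Nat.Properties as ℕ
open import Data.Product.Base using (∃-syntax; _×_; _,_)
open import Data.Rational.Base as ℚ using (ℚ; 0ℚ; 1ℚ; ½)
import Data.Rational.Properties as ℚ
open import Data.Vec.Base using (lookup)
open import Data.Vec.Functional using (foldr)
open import Relation.Binary.PropositionalEquality
  using (_≡_; refl; sym; trans; cong; cong₂; subst)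
open import Relation.Nullary using (¬_)
open import Relation.Nullary.Decidable using (_×-dec_)

-- The real numbers are Cauchy sequences of rationals, with equality _≃_,
-- arithmetic taken pointwise, and order relations that only look at tails.

IsCauchy : (ℕ → ℚ) → Set
IsCauchy x = ∀ (δ : ℚ) → 0ℚ ℚ.< δ →
  ∃[ N ] (∀ m n → N ℕ.≤ m → N ℕ.≤ n → ℚ.∣ x m ℚ.- x n ∣ ℚ.< δ)

record ℝ : Set where
  constructor mkℝ
  field
    seq    : ℕ → ℚ
    cauchy : IsCauchy seq

open ℝ public

private
  open CommutativeSemigroupProperties
    (CommutativeMonoid.commutativeSemigroup ℚ.+-0-commutativeMonoid)
    using (interchange)

  telescope : ∀ p r q → (p ℚ.- r) ℚ.+ (r ℚ.- q) ≡ p ℚ.- q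
  telescope p r q = trans (ℚ.+-assoc p (ℚ.- r) (r ℚ.- q)) (cong (p ℚ.+_)
    (trans (sym (ℚ.+-assoc (ℚ.- r) r (ℚ.- q)))
    (trans (cong (ℚ._- q) (ℚ.+-inverseˡ r)) (ℚ.+-identityˡ (ℚ.- q)))))

  *-distrib-- : ∀ p q r → p ℚ.* (q ℚ.- r) ≡ p ℚ.* q ℚ.- p ℚ.* r
  *-distrib-- p q r = trans (ℚ.*-distribˡ-+ p q (ℚ.- r))
    (cong (p ℚ.* q ℚ.+_) (sym (ℚ.neg-distribʳ-* p r)))

  halve : ∀ δ → ½ ℚ.* δ ℚ.+ ½ ℚ.* δ ≡ δ
  halve δ = trans (sym (ℚ.*-distribʳ-+ δ ½ ½)) (ℚ.*-identityˡ δ)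

  half-pos : ∀ {δ} → 0ℚ ℚ.< δ → 0ℚ ℚ.< ½ ℚ.* δ
  half-pos {δ} δ>0 = subst (ℚ._< ½ ℚ.* δ) (ℚ.*-zeroʳ ½) (ℚ.*-monoʳ-<-pos ½ δ>0)

  const-cauchy : ∀ q → IsCauchy (λ _ → q)
  const-cauchy q δ δ>0 = 0 , λ _ _ _ _ →
    subst (λ r → ℚ.∣ r ∣ ℚ.< δ) (sym (ℚ.+-inverseʳ q)) δ>0

  neg-cauchy : ∀ x → IsCauchy x → IsCauchy (λ n → ℚ.- x n)
  neg-cauchy x cx δ δ>0 with cx δ δ>0
  ... | N , p = N , λ m n N≤m N≤n →
    subst (ℚ._< δ)
      (trans (sym (ℚ.∣-p∣≡∣p∣ (x m ℚ.- x n))) (cong ℚ.∣_∣ (ℚ.neg-distrib-+ (x m) (ℚ.- x n))))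
      (p m n N≤m N≤n)

  +-cauchy : ∀ x y → IsCauchy x → IsCauchy y → IsCauchy (λ n → x n ℚ.+ y n)
  +-cauchy x y cx cy δ δ>0
    with cx (½ ℚ.* δ) (half-pos δ>0) | cy (½ ℚ.* δ) (half-pos δ>0)
  ... | M , p | N , q = M ℕ.⊔ N , λ m n l k →
    let M≤ = λ {i} → ℕ.≤-trans {k = i} (ℕ.m≤m⊔n M N)
        N≤ = λ {i} → ℕ.≤-trans {k = i} (ℕ.m≤n⊔m M N)
    in begin-strict
      ℚ.∣ (x m ℚ.+ y m) ℚ.- (x n ℚ.+ y n) ∣
        ≡⟨ cong ℚ.∣_∣ (lemma (x m) (y m) (x n) (y n)) ⟩
      ℚ.∣ (x m ℚ.- x n) ℚ.+ (y m ℚ.- y n) ∣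
        ≤⟨ ℚ.∣p+q∣≤∣p∣+∣q∣ (x m ℚ.- x n) (y m ℚ.- y n) ⟩
      ℚ.∣ x m ℚ.- x n ∣ ℚ.+ ℚ.∣ y m ℚ.- y n ∣
        <⟨ ℚ.+-mono-< (p m n (M≤ l) (M≤ k)) (q m n (N≤ l) (N≤ k)) ⟩
      ½ ℚ.* δ ℚ.+ ½ ℚ.* δ
        ≡⟨ halve δ ⟩
      δ ∎
    where
    open ℚ.≤-Reasoning
    lemma : ∀ a b c d → (a ℚ.+ b) ℚ.- (c ℚ.+ d) ≡ (a ℚ.- c) ℚ.+ (b ℚ.- d)
    lemma a b c d = trans (cong ((a ℚ.+ b) ℚ.+_) (ℚ.neg-distrib-+ c d))
      (interchange a b (ℚ.- c) (ℚ.- d))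

  eventually-bounded : ∀ x → IsCauchy x →
    ∃[ B ] ∃[ N ] 0ℚ ℚ.< B × (∀ n → N ℕ.≤ n → ℚ.∣ x n ∣ ℚ.≤ B)
  eventually-bounded x cx with cx 1ℚ (ℚ.positive⁻¹ 1ℚ)
  ... | N , p = 1ℚ ℚ.+ ℚ.∣ x N ∣ , N
    , ℚ.+-mono-<-≤ (ℚ.positive⁻¹ 1ℚ) (ℚ.0≤∣p∣ (x N))
    , λ n N≤n → begin
      ℚ.∣ x n ∣
        ≡⟨ cong ℚ.∣_∣ (lemma (x n) (x N)) ⟩
      ℚ.∣ (x n ℚ.- x N) ℚ.+ x N ∣
        ≤⟨ ℚ.∣p+q∣≤∣p∣+∣q∣ (x n ℚ.- x N) (x N) ⟩
      ℚ.∣ x n ℚ.- x N ∣ ℚ.+ ℚ.∣ x N ∣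
        ≤⟨ ℚ.+-monoˡ-≤ ℚ.∣ x N ∣ (ℚ.<⇒≤ (p n N N≤n ℕ.≤-refl)) ⟩
      1ℚ ℚ.+ ℚ.∣ x N ∣ ∎
    where
    open ℚ.≤-Reasoning
    lemma : ∀ a b → a ≡ (a ℚ.- b) ℚ.+ b
    lemma a b = sym (trans (ℚ.+-assoc a (ℚ.- b) b)
      (trans (cong (a ℚ.+_) (ℚ.+-inverseˡ b)) (ℚ.+-identityʳ a)))

  shrink : ∀ {B δ} → 0ℚ ℚ.< B → 0ℚ ℚ.< δ →
    ∃[ η ] 0ℚ ℚ.< η × B ℚ.* η ≡ δ
  shrink {B} {δ} B>0 δ>0 = B⁻¹ ℚ.* δ
    , subst (ℚ._< B⁻¹ ℚ.* δ) (ℚ.*-zeroʳ B⁻¹)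
        (ℚ.*-monoʳ-<-pos B⁻¹ {{ℚ.1/pos⇒pos B}} δ>0)
    , trans (sym (ℚ.*-assoc B B⁻¹ δ))
        (trans (cong (ℚ._* δ) (ℚ.*-inverseʳ B)) (ℚ.*-identityˡ δ))
    where
    instance
      B-pos : ℚ.Positive B
      B-pos = ℚ.positive B>0
      B-nz : ℚ.NonZero B
      B-nz = ℚ.pos⇒nonZero B
    B⁻¹ : ℚ
    B⁻¹ = ℚ.1/ B

  ∣*∣-bound : ∀ a b {B η} → 0ℚ ℚ.< B → ℚ.∣ a ∣ ℚ.≤ B → ℚ.∣ b ∣ ℚ.< η →
    ℚ.∣ a ℚ.* b ∣ ℚ.< B ℚ.* η
  ∣*∣-bound a b {B} {η} B>0 a≤B b<η = begin-strict
    ℚ.∣ a ℚ.* b ∣        ≡⟨ ℚ.∣p*q∣≡∣p∣*∣q∣ a b ⟩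
    ℚ.∣ a ∣ ℚ.* ℚ.∣ b ∣  ≤⟨ ℚ.*-monoʳ-≤-nonNeg ℚ.∣ b ∣ {{ℚ.nonNegative (ℚ.0≤∣p∣ b)}} a≤B ⟩
    B ℚ.* ℚ.∣ b ∣        <⟨ ℚ.*-monoʳ-<-pos B {{ℚ.positive B>0}} b<η ⟩
    B ℚ.* η              ∎
    where open ℚ.≤-Reasoning

  *-cauchy : ∀ x y → IsCauchy x → IsCauchy y → IsCauchy (λ n → x n ℚ.* y n)
  *-cauchy x y cx cy δ δ>0
    with eventually-bounded x cx | eventually-bounded y cy
  ... | B , M₁ , B>0 , ∣x∣≤B | C , M₂ , C>0 , ∣y∣≤C
    with shrink B>0 (half-pos δ>0) | shrink C>0 (half-pos δ>0)
  ... | η , η>0 , Bη≡ | ζ , ζ>0 , Cζ≡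
    with cy η η>0 | cx ζ ζ>0
  ... | M₃ , q | M₄ , p = (M₁ ℕ.⊔ M₂) ℕ.⊔ (M₃ ℕ.⊔ M₄) , λ m n l k →
    begin-strict
      ℚ.∣ x m ℚ.* y m ℚ.- x n ℚ.* y n ∣
        ≡⟨ cong ℚ.∣_∣ (lemma (x m) (y m) (x n) (y n)) ⟩
      ℚ.∣ x m ℚ.* (y m ℚ.- y n) ℚ.+ y n ℚ.* (x m ℚ.- x n) ∣
        ≤⟨ ℚ.∣p+q∣≤∣p∣+∣q∣ (x m ℚ.* (y m ℚ.- y n)) (y n ℚ.* (x m ℚ.- x n)) ⟩
      ℚ.∣ x m ℚ.* (y m ℚ.- y n) ∣ ℚ.+ ℚ.∣ y n ℚ.* (x m ℚ.- x n) ∣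
        <⟨ ℚ.+-mono-<
             (∣*∣-bound (x m) (y m ℚ.- y n) B>0 (∣x∣≤B m (≥₁ l)) (q m n (≥₃ l) (≥₃ k)))
             (∣*∣-bound (y n) (x m ℚ.- x n) C>0 (∣y∣≤C n (≥₂ k)) (p m n (≥₄ l) (≥₄ k))) ⟩
      B ℚ.* η ℚ.+ C ℚ.* ζ
        ≡⟨ cong₂ ℚ._+_ Bη≡ Cζ≡ ⟩
      ½ ℚ.* δ ℚ.+ ½ ℚ.* δ
        ≡⟨ halve δ ⟩
      δ ∎
    where
    open ℚ.≤-Reasoning
    lemma : ∀ a b c d → a ℚ.* b ℚ.- c ℚ.* d ≡ a ℚ.* (b ℚ.- d) ℚ.+ d ℚ.* (a ℚ.- c)
    lemma a b c d = sym (begin-equality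
      a ℚ.* (b ℚ.- d) ℚ.+ d ℚ.* (a ℚ.- c)
        ≡⟨ cong₂ ℚ._+_ (*-distrib-- a b d) (*-distrib-- d a c) ⟩
      (a ℚ.* b ℚ.- a ℚ.* d) ℚ.+ (d ℚ.* a ℚ.- d ℚ.* c)
        ≡⟨ cong₂ (λ u v → (a ℚ.* b ℚ.- a ℚ.* d) ℚ.+ (u ℚ.- v))
             (ℚ.*-comm d a) (ℚ.*-comm d c) ⟩
      (a ℚ.* b ℚ.- a ℚ.* d) ℚ.+ (a ℚ.* d ℚ.- c ℚ.* d)
        ≡⟨ telescope (a ℚ.* b) (a ℚ.* d) (c ℚ.* d) ⟩
      a ℚ.* b ℚ.- c ℚ.* d ∎)
    N : ℕ
    N = (M₁ ℕ.⊔ M₂) ℕ.⊔ (M₃ ℕ.⊔ M₄)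
    ≥₁ : ∀ {i} → N ℕ.≤ i → M₁ ℕ.≤ i
    ≥₁ l = ℕ.m⊔n≤o⇒m≤o M₁ M₂ (ℕ.m⊔n≤o⇒m≤o (M₁ ℕ.⊔ M₂) (M₃ ℕ.⊔ M₄) l)
    ≥₂ : ∀ {i} → N ℕ.≤ i → M₂ ℕ.≤ i
    ≥₂ l = ℕ.m⊔n≤o⇒n≤o M₁ M₂ (ℕ.m⊔n≤o⇒m≤o (M₁ ℕ.⊔ M₂) (M₃ ℕ.⊔ M₄) l)
    ≥₃ : ∀ {i} → N ℕ.≤ i → M₃ ℕ.≤ i
    ≥₃ l = ℕ.m⊔n≤o⇒m≤o M₃ M₄ (ℕ.m⊔n≤o⇒n≤o (M₁ ℕ.⊔ M₂) (M₃ ℕ.⊔ M₄) l)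
    ≥₄ : ∀ {i} → N ℕ.≤ i → M₄ ℕ.≤ i
    ≥₄ l = ℕ.m⊔n≤o⇒n≤o M₃ M₄ (ℕ.m⊔n≤o⇒n≤o (M₁ ℕ.⊔ M₂) (M₃ ℕ.⊔ M₄) l)

infix  4 _<_ _≤_ _≃_
infixl 6 _+_ _-_
infixl 7 _*_
infix  8 -_

fromℚ : ℚ → ℝ
fromℚ q = mkℝ (λ _ → q) (const-cauchy q)

fromℕ : ℕ → ℝ
fromℕ n = fromℚ (+ n ℚ./ 1)

0ℝ 1ℝ : ℝ
0ℝ = fromℕ 0
1ℝ = fromℕ 1

_+_ _*_ : ℝ → ℝ → ℝ
x + y = mkℝ (λ n → seq x n ℚ.+ seq y n) (+-cauchy (seq x) (seq y) (cauchy x) (cauchy y))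
x * y = mkℝ (λ n → seq x n ℚ.* seq y n) (*-cauchy (seq x) (seq y) (cauchy x) (cauchy y))

-_ : ℝ → ℝ
- x = mkℝ (λ n → ℚ.- seq x n) (neg-cauchy (seq x) (cauchy x))

_-_ : ℝ → ℝ → ℝ
x - y = x + (- y)

_<_ _≤_ _≃_ : ℝ → ℝ → Set
x < y = ∃[ δ ] 0ℚ ℚ.< δ × ∃[ N ] (∀ n → N ℕ.≤ n → seq x n ℚ.+ δ ℚ.≤ seq y n)
x ≤ y = ∀ δ → 0ℚ ℚ.< δ → ∃[ N ] (∀ n → N ℕ.≤ n → seq x n ℚ.≤ seq y n ℚ.+ δ)
x ≃ y = ∀ δ → 0ℚ ℚ.< δ → ∃[ N ] (∀ n → N ℕ.≤ n → ℚ.∣ seq x n ℚ.- seq y n ∣ ℚ.< δ)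

∑ : ∀ {n} → (Fin n → ℝ) → ℝ
∑ = foldr _+_ 0ℝ

-- A simple graph on the vertex set Fin n with positive edge weights.  The
-- value of weight on non-adjacent pairs is irrelevant: no definition uses it.
record Graph (n : ℕ) : Set where
  field
    adj        : Fin n → Fin n → Bool
    adj-sym    : ∀ i j → T (adj i j) → T (adj j i)
    adj-irrefl : ∀ i → ¬ T (adj i i)
    weight     : Fin n → Fin n → ℝ
    weight-sym : ∀ i j → T (adj i j) → weight i j ≃ weight j i
    weight-pos : ∀ i j → T (adj i j) → 0ℝ < weight i j

open Graph public

-- Each undirected edge is listed once, as the pair with smaller endpoint first.
edges : ∀ {n} → Graph n → List (Fin n × Fin n)
edges {n} G = filter (λ { (i , j) → (i <? j) ×-dec T? (adj G i j) })
                     (cartesianProduct (allFin n) (allFin n))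

numEdges : ∀ {n} → Graph n → ℕ
numEdges G = length (edges G)

-- Each crossing edge contributes once, through its orientation with i ∈ S, j ∉ S.
cutWeight : ∀ {n} → Graph n → Subset n → ℝ
cutWeight G S = ∑ λ i → ∑ λ j →
  if lookup S i ∧ not (lookup S j) ∧ adj G i j then weight G i j else 0ℝ

-- H is a (1 + ε)-cut sparsifier of G.
IsCutSparsifier : ∀ {n} → ℝ → Graph n → Graph n → Set
IsCutSparsifier {n} ε G H = ∀ (S : Subset n) →
    (1ℝ - ε) * cutWeight G S ≤ cutWeight H S
  × cutWeight H S ≤ (1ℝ + ε) * cutWeight G S

-- The graph is the complete bipartite graph between a side of r² vertices and the
-- remaining p, with r of order 1/ε.  For signs y and x on the two sides, the form
-- Σ xᵢ bᵢⱼ yⱼ with b = (weights of H) - (weights of G) is a signed sum of four cut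
-- errors, hence at most of order ε p r².  Choosing xᵢ to be the sign of row i and y at
-- random, row i contributes a mean of |Σⱼ bᵢⱼ yⱼ|.  By convexity the entries at edges
-- of H may be replaced by 0, and at the dᵢ ≤ r² non-edges b is constant, so second and
-- fourth moments bound this mean below by a multiple of dᵢ / r.  Hence Σ dᵢ is at most
-- half of p r², and H has at least p r² / 2 edges.  When ε is too large for this, r = 1
-- suffices: G is a star, and H cannot isolate a leaf.

module Submission where

open import Algebra.Bundles using (CommutativeRing)
import Algebra.Properties.Semiring.Sum as SemiringSum
open import Data.Bool.Base using (Bool; true; false; T; not; _∧_; if_then_else_)
open import Data.Bool.Properties using (T?)
open import Data.Empty using (⊥; ⊥-elim)
open import Data.Fin.Base using (Fin; zero; suc; _↑ˡ_; _↑ʳ_; splitAt; toℕ)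
import Data.Fin.Properties as Fin
open import Data.Fin.Subset using (Subset)
import Data.Integer.Base as ℤ
import Data.Integer.Properties as ℤ
open import Data.List.Base as List using (length; filter; cartesianProduct)
import Data.List.Properties as List
open import Data.Nat.Base as ℕ using (ℕ; zero; suc)
import Data.Nat.Coprimality as ℕ
import Data.Nat.Properties as ℕ
open import Data.Product.Base using (_×_; _,_; proj₁; proj₂; ∃-syntax; Σ-syntax)
open import Data.Rational.Base as ℚ using (ℚ; 0ℚ; 1ℚ; ½)
import Data.Rational.Properties as ℚ
open import Data.Rational.Solver using (module +-*-Solver)
open import Data.Sum.Base using (_⊎_; inj₁; inj₂)
open import Data.Unit.Base using (tt)
open import Data.Vec.Base using (Vec; []; _∷_; _++_; map; lookup; tabulate)
import Data.Vec.Properties as Vec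
open import Function.Base using (_∘_)
open import Relation.Binary.Definitions using (tri<; tri≈; tri>)
open import Relation.Binary.PropositionalEquality
  using (_≡_; refl; sym; trans; cong; cong₂; subst; subst₂; module ≡-Reasoning)
open import Relation.Nullary using (¬_; Dec; does; yes; no)
open import Relation.Nullary.Decidable using (dec-true; dec-false)
open import Relation.Unary using (Decidable)

-- `H` may have edges inside a side and weights of any size, and both obstacles shape the argument.
-- Edges inside a side are removed by the choice of the four cuts: such an edge contributes equally
-- to the positive and to the negative pair. At an edge of `H` nothing is known about the error, so
-- only absent edges, where the error is dictated by `G`, can force the form to be large; this is
-- why the count concerns non-edges.
--
-- The scale of `r` comes from comparing the two estimates. The rows have total absolute value at
-- most about `2 ε p r²`, while non-edges contribute `Σ dᵢ / r`. Hence `Σ dᵢ` is at most about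
-- `2 r ε` times `p r²`, which is half of it when `4 r ε ≤ 1`.
--
-- Order on Cauchy reals holds only up to a slack on a tail and is not decidable. The combinatorics
-- therefore takes place over ℚ at one index of the sequences, with an additive slack `η` that is
-- paid for by a rational number chosen strictly above `ε`.

private module ℕ∑ = SemiringSum ℕ.+-*-semiring

module RationalInequalities where

  open import Data.Rational.Base
  open import Data.Rational.Properties
  open +-*-Solver using (Polynomial; solve; con; _:=_; _:+_; _:*_; _:-_; :-_)

  open SemiringSum (CommutativeRing.semiring +-*-commutativeRing) public

  -- Naturals as rationals, and certified inequalities.

  ι : ℕ → ℚ
  ι n = ℤ.+ n / 1

  ι≡mkℚ : ∀ n → ι n ≡ mkℚ (ℤ.+ n) 0 (ℕ.sym (ℕ.1-coprimeTo n))
  ι≡mkℚ n = ↥p/↧p≡p (mkℚ (ℤ.+ n) 0 (ℕ.sym (ℕ.1-coprimeTo n)))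

  ι-+ : ∀ m n → ι (m ℕ.+ n) ≡ ι m + ι n
  ι-+ m n = begin
    ℤ.+ (m ℕ.+ n) / 1                      ≡⟨ cong (_/ 1) (cong₂ ℤ._+_ (ℤ.*-identityʳ (ℤ.+ m)) (ℤ.*-identityʳ (ℤ.+ n))) ⟨
    (ℤ.+ m ℤ.* ℤ.+ 1 ℤ.+ ℤ.+ n ℤ.* ℤ.+ 1) / 1    ≡⟨ cong₂ _+_ (ι≡mkℚ m) (ι≡mkℚ n) ⟨
    ι m + ι n                            ∎
    where open ≡-Reasoning

  ι-* : ∀ m n → ι (m ℕ.* n) ≡ ι m * ι n
  ι-* m n = begin
    ℤ.+ (m ℕ.* n) / 1      ≡⟨ cong (_/ 1) (ℤ.pos-* m n) ⟩
    (ℤ.+ m ℤ.* ℤ.+ n) / 1    ≡⟨ cong₂ _*_ (ι≡mkℚ m) (ι≡mkℚ n) ⟨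
    ι m * ι n            ∎
    where open ≡-Reasoning

  ι-mono-≤ : ∀ {m n} → m ℕ.≤ n → ι m ≤ ι n
  ι-mono-≤ {m} {n} m≤n = subst₂ _≤_ (sym (ι≡mkℚ m)) (sym (ι≡mkℚ n))
    (*≤* (ℤ.*-monoʳ-≤-nonNeg (ℤ.+ 1) (ℤ.+≤+ m≤n)))

  ι-cancel-≤ : ∀ {m n} → ι m ≤ ι n → m ℕ.≤ n
  ι-cancel-≤ {m} {n} ιm≤ιn with subst₂ _≤_ (ι≡mkℚ m) (ι≡mkℚ n) ιm≤ιn
  ... | *≤* q = ℤ.drop‿+≤+ (ℤ.*-cancelʳ-≤-pos (ℤ.+ m) (ℤ.+ n) (ℤ.+ 1) q)

  0≤ι : ∀ n → 0ℚ ≤ ι n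
  0≤ι n = ι-mono-≤ {0} {n} ℕ.z≤n

  -- The format of the polynomial inequalities below: `e` is the difference of the two sides,
  -- written so that its sign is visible, and the ring solver checks the identity.
  ≤-slack : ∀ {p q} e → 0ℚ ≤ e → p + e ≡ q → p ≤ q
  ≤-slack {p} e 0≤e refl = subst (_≤ p + e) (+-identityʳ p) (+-monoʳ-≤ p 0≤e)

  0≤-diff : ∀ {p q} → p ≤ q → 0ℚ ≤ q - p
  0≤-diff {p} {q} p≤q = subst (_≤ q - p) (+-inverseʳ p) (+-monoˡ-≤ (- p) p≤q)

  0≤+ : ∀ {p q} → 0ℚ ≤ p → 0ℚ ≤ q → 0ℚ ≤ p + q
  0≤+ = +-mono-≤

  0≤* : ∀ {p q} → 0ℚ ≤ p → 0ℚ ≤ q → 0ℚ ≤ p * q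
  0≤* {p} {q} 0≤p 0≤q = subst (_≤ p * q) (*-zeroʳ p)
    (*-monoˡ-≤-nonNeg p {{nonNegative 0≤p}} 0≤q)

  0≤square : ∀ p → 0ℚ ≤ p * p
  0≤square p with ≤-total 0ℚ p
  ... | inj₁ 0≤p = 0≤* 0≤p 0≤p
  ... | inj₂ p≤0 = subst (0ℚ ≤_) (solve 1 (λ x → (:- x) :* (:- x) := x :* x) refl p)
    (0≤* (neg-antimono-≤ p≤0) (neg-antimono-≤ p≤0))

  ∣p∣*∣p∣≡p*p : ∀ p → ∣ p ∣ * ∣ p ∣ ≡ p * p
  ∣p∣*∣p∣≡p*p p = trans (sym (∣p*q∣≡∣p∣*∣q∣ p p)) (0≤p⇒∣p∣≡p (0≤square p))

  *-cancelˡ-≤ : ∀ r {p q} → 0ℚ < r → r * p ≤ r * q → p ≤ q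
  *-cancelˡ-≤ r 0<r = *-cancelˡ-≤-pos r {{positive 0<r}}

  -- Finite sums of rationals.

  sum-mono-≤ : ∀ {n} {f g : Fin n → ℚ} → (∀ i → f i ≤ g i) → sum f ≤ sum g
  sum-mono-≤ {zero}  f≤g = ≤-refl
  sum-mono-≤ {suc n} f≤g = +-mono-≤ (f≤g zero) (sum-mono-≤ (f≤g ∘ suc))

  sum-nonNeg : ∀ {n} {f : Fin n → ℚ} → (∀ i → 0ℚ ≤ f i) → 0ℚ ≤ sum f
  sum-nonNeg {zero}  0≤f = ≤-refl
  sum-nonNeg {suc n} 0≤f = 0≤+ (0≤f zero) (sum-nonNeg (0≤f ∘ suc))

  term≤sum : ∀ {n} {f : Fin n → ℚ} → (∀ i → 0ℚ ≤ f i) → ∀ k → f k ≤ sum f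
  term≤sum {f = f} 0≤f zero    = ≤-slack _ (sum-nonNeg (0≤f ∘ suc)) refl
  term≤sum {f = f} 0≤f (suc k) = ≤-trans (term≤sum (0≤f ∘ suc) k)
    (≤-slack (f zero) (0≤f zero) (+-comm _ (f zero)))

  sum-zero : ∀ {n} {f : Fin n → ℚ} → (∀ i → f i ≡ 0ℚ) → sum f ≡ 0ℚ
  sum-zero {n} f≡0 = trans (sum-cong-≗ f≡0) (sum-replicate-zero n)

  sum-const : ∀ n q → sum {n} (λ _ → q) ≡ ι n * q
  sum-const zero    q = sym (*-zeroˡ q)
  sum-const (suc n) q = begin
    q + sum {n} (λ _ → q)  ≡⟨ cong (q +_) (sum-const n q) ⟩
    q + ι n * q            ≡⟨ solve 2 (λ q x → q :+ x :* q := (con 1ℚ :+ x) :* q) refl q (ι n) ⟩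
    (ι 1 + ι n) * q        ≡⟨ cong (_* q) (ι-+ 1 n) ⟨
    ι (suc n) * q          ∎
    where open ≡-Reasoning

  sum-↑ : ∀ s {p} (f : Fin (s ℕ.+ p) → ℚ) → sum f ≡ sum (λ j → f (j ↑ˡ p)) + sum (λ i → f (s ↑ʳ i))
  sum-↑ zero    f = sym (+-identityˡ _)
  sum-↑ (suc s) f = trans (cong (f zero +_) (sum-↑ s (f ∘ suc))) (sym (+-assoc (f zero) _ _))

  sum-↑² : ∀ s {p} (f : Fin (s ℕ.+ p) → Fin (s ℕ.+ p) → ℚ) → sum (λ i → sum (f i)) ≡
    (sum (λ j → sum λ j′ → f (j ↑ˡ p) (j′ ↑ˡ p)) + sum (λ j → sum λ i → f (j ↑ˡ p) (s ↑ʳ i))) +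
    (sum (λ i → sum λ j → f (s ↑ʳ i) (j ↑ˡ p)) + sum (λ i → sum λ i′ → f (s ↑ʳ i) (s ↑ʳ i′)))
  sum-↑² s {p} f = begin
    sum (λ i → sum (f i))
      ≡⟨ sum-↑ s (λ i → sum (f i)) ⟩
    sum (λ j → sum (f (j ↑ˡ p))) + sum (λ i → sum (f (s ↑ʳ i)))
      ≡⟨ cong₂ _+_ (sum-cong-≗ (λ j → sum-↑ s (f (j ↑ˡ p)))) (sum-cong-≗ (λ i → sum-↑ s (f (s ↑ʳ i)))) ⟩
    sum (λ j → sum (λ j′ → f (j ↑ˡ p) (j′ ↑ˡ p)) + sum (λ i → f (j ↑ˡ p) (s ↑ʳ i))) +
    sum (λ i → sum (λ j → f (s ↑ʳ i) (j ↑ˡ p)) + sum (λ i′ → f (s ↑ʳ i) (s ↑ʳ i′)))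
      ≡⟨ cong₂ _+_ (∑-distrib-+ _ (λ j → sum λ i → f (j ↑ˡ p) (s ↑ʳ i)))
                   (∑-distrib-+ _ (λ i → sum λ i′ → f (s ↑ʳ i) (s ↑ʳ i′))) ⟩
    _ ∎
    where open ≡-Reasoning

  -- Absolute first moments of sums of random signs.

  -- The mean of ∣ v + Y ∣, where Y is a sum of d independent uniform signs ±2.
  meanAbs : ℕ → ℚ → ℚ
  meanAbs zero    v = ∣ v ∣
  meanAbs (suc d) v = ½ * (meanAbs d (v + ι 2) + meanAbs d (v - ι 2))

  -- Jensen's inequality for a two-point average: the base case is the triangle inequality, and
  -- averaging over further signs preserves it. The shift `b` is arbitrary because it will be the
  -- error at an edge of `H`, which has no bound.
  meanAbs-convex : ∀ d v b → meanAbs d v ≤ ½ * (meanAbs d (v + b) + meanAbs d (v - b))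
  meanAbs-convex zero v b = begin
    ∣ v ∣                            ≡⟨ cong ∣_∣ (solve 2 (λ v b → v := con ½ :* ((v :+ b) :+ (v :- b))) refl v b) ⟩
    ∣ ½ * ((v + b) + (v - b)) ∣      ≡⟨ ∣p*q∣≡∣p∣*∣q∣ ½ ((v + b) + (v - b)) ⟩
    ½ * ∣ (v + b) + (v - b) ∣        ≤⟨ *-monoˡ-≤-nonNeg ½ (∣p+q∣≤∣p∣+∣q∣ (v + b) (v - b)) ⟩
    ½ * (∣ v + b ∣ + ∣ v - b ∣)      ∎
    where open ≤-Reasoning
  meanAbs-convex (suc d) v b = begin
    ½ * (meanAbs d (v + ι 2) + meanAbs d (v - ι 2))
      ≤⟨ *-monoˡ-≤-nonNeg ½ (+-mono-≤ (meanAbs-convex d (v + ι 2) b) (meanAbs-convex d (v - ι 2) b)) ⟩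
    ½ * (½ * (meanAbs d (v + ι 2 + b) + meanAbs d (v + ι 2 - b)) + ½ * (meanAbs d (v - ι 2 + b) + meanAbs d (v - ι 2 - b)))
      ≡⟨ solve 4 (λ x y z w → con ½ :* (con ½ :* (x :+ y) :+ con ½ :* (z :+ w))
            := con ½ :* (con ½ :* (x :+ z) :+ con ½ :* (y :+ w))) refl
            (meanAbs d (v + ι 2 + b)) (meanAbs d (v + ι 2 - b)) (meanAbs d (v - ι 2 + b)) (meanAbs d (v - ι 2 - b)) ⟩
    ½ * (½ * (meanAbs d (v + ι 2 + b) + meanAbs d (v - ι 2 + b)) + ½ * (meanAbs d (v + ι 2 - b) + meanAbs d (v - ι 2 - b)))
      ≡⟨ cong (½ *_) (cong₂ _+_
           (cong (½ *_) (cong₂ _+_ (cong (meanAbs d) (swap (ι 2) b)) (cong (meanAbs d) (swap (- ι 2) b))))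
           (cong (½ *_) (cong₂ _+_ (cong (meanAbs d) (swap (ι 2) (- b))) (cong (meanAbs d) (swap (- ι 2) (- b)))))) ⟩
    ½ * (meanAbs (suc d) (v + b) + meanAbs (suc d) (v - b)) ∎
    where
    open ≤-Reasoning
    swap : ∀ x y → v + x + y ≡ v + y + x
    swap = solve 3 (λ v x y → v :+ x :+ y := v :+ y :+ x) refl v

  -- The mean of 3t²w² - w⁴ at w = v + Y with Y as above.  This polynomial is at
  -- most 2t³∣w∣, because the difference is ∣w∣(∣w∣ - t)²(∣w∣ + 2t).
  moments : ℚ → ℚ → ℚ → ℚ
  moments t d v = ι 3 * (t * t) * (v * v + ι 4 * d)
    - (v * v * (v * v) + ι 24 * d * (v * v) + ι 48 * (d * d) - ι 32 * d)

  -- `moments` satisfies the recursion of `meanAbs` exactly, so the pointwise bound is needed only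
  -- at `d = 0`. The coefficients `24`, `48` and `-32` are what this recursion makes of the fourth
  -- moment.
  moments≤meanAbs : ∀ {t} → 0ℚ ≤ t → ∀ d v → moments t (ι d) v ≤ ι 2 * (t * t * t) * meanAbs d v
  moments≤meanAbs {t} 0≤t zero v = ≤-slack (w * ((w - t) * (w - t)) * (w + ι 2 * t))
    (0≤* (0≤* (0≤∣p∣ v) (0≤square (w - t))) (0≤+ (0≤∣p∣ v) (0≤* (0≤ι 2) 0≤t)))
    (begin
      moments t 0ℚ v + w * ((w - t) * (w - t)) * (w + ι 2 * t)
        ≡⟨ cong (_+ w * ((w - t) * (w - t)) * (w + ι 2 * t)) (solve 2 (λ t v →
            con (ι 3) :* (t :* t) :* (v :* v :+ con (ι 4) :* con 0ℚ)
            :- (v :* v :* (v :* v) :+ con (ι 24) :* con 0ℚ :* (v :* v)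
              :+ con (ι 48) :* (con 0ℚ :* con 0ℚ) :- con (ι 32) :* con 0ℚ)
            := con (ι 3) :* (t :* t) :* (v :* v) :- v :* v :* (v :* v)) refl t v) ⟩
      (ι 3 * (t * t) * (v * v) - v * v * (v * v)) + w * ((w - t) * (w - t)) * (w + ι 2 * t)
        ≡⟨ cong (λ z → (ι 3 * (t * t) * z - z * z) + w * ((w - t) * (w - t)) * (w + ι 2 * t))
             (∣p∣*∣p∣≡p*p v) ⟨
      (ι 3 * (t * t) * (w * w) - w * w * (w * w)) + w * ((w - t) * (w - t)) * (w + ι 2 * t)
        ≡⟨ solve 2 (λ t w → (con (ι 3) :* (t :* t) :* (w :* w) :- w :* w :* (w :* w))
            :+ w :* ((w :- t) :* (w :- t)) :* (w :+ con (ι 2) :* t)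
            := con (ι 2) :* (t :* t :* t) :* w) refl t w ⟩
      ι 2 * (t * t * t) * w ∎)
    where
    open ≡-Reasoning
    w = ∣ v ∣
  moments≤meanAbs {t} 0≤t (suc d) v = begin
    moments t (ι (suc d)) v
      ≡⟨ cong (λ x → moments t x v) (ι-+ 1 d) ⟩
    moments t (ι 1 + ι d) v
      ≡⟨ solve 3 (λ t d v → moments′ t (con (ι 1) :+ d) v
           := con ½ :* (moments′ t d (v :+ con (ι 2)) :+ moments′ t d (v :- con (ι 2)))) refl t (ι d) v ⟩
    ½ * (moments t (ι d) (v + ι 2) + moments t (ι d) (v - ι 2))
      ≤⟨ *-monoˡ-≤-nonNeg ½ (+-mono-≤ (moments≤meanAbs 0≤t d (v + ι 2)) (moments≤meanAbs 0≤t d (v - ι 2))) ⟩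
    ½ * (ι 2 * (t * t * t) * meanAbs d (v + ι 2) + ι 2 * (t * t * t) * meanAbs d (v - ι 2))
      ≡⟨ solve 3 (λ t x y → con ½ :* (con (ι 2) :* (t :* t :* t) :* x :+ con (ι 2) :* (t :* t :* t) :* y)
           := con (ι 2) :* (t :* t :* t) :* (con ½ :* (x :+ y))) refl t (meanAbs d (v + ι 2)) (meanAbs d (v - ι 2)) ⟩
    ι 2 * (t * t * t) * meanAbs (suc d) v ∎
    where
    open ≤-Reasoning
    moments′ : ∀ {n} → Polynomial n → Polynomial n → Polynomial n → Polynomial n
    moments′ t d v = con (ι 3) :* (t :* t) :* (v :* v :+ con (ι 4) :* d)
      :- (v :* v :* (v :* v) :+ con (ι 24) :* d :* (v :* v) :+ con (ι 48) :* (d :* d) :- con (ι 32) :* d)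

  -- The parameter is `t = 4 r`, twice the bound `2 r` on the standard deviation of `Y`. At `v = 0`
  -- the moments are `192 r² d - 48 d² + 32 d`, and `d ≤ r²` keeps the loss `48 d²` within
  -- `48 r² d`. This leaves at least the `128 r² d` that matches `2 t³ = 128 r³`.
  meanAbs-lower : ∀ r d → 1 ℕ.≤ r → d ℕ.≤ r ℕ.* r → ι d ≤ ι r * meanAbs d 0ℚ
  meanAbs-lower r d 1≤r d≤r² = *-cancelˡ-≤ (ι 128 * (x * x)) 128x²>0 (begin
    ι 128 * (x * x) * ι d
      ≤⟨ ≤-slack
           (ι 48 * (ι d * (x * x - ι d)) + (ι 16 * (x * x) * ι d + ι 32 * ι d))
           (0≤+ (0≤* (0≤ι 48) (0≤* (0≤ι d) (0≤-diff (subst (ι d ≤_) (ι-* r r) (ι-mono-≤ d≤r²)))))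
             (0≤+ (0≤* (0≤* (0≤ι 16) (0≤square x)) (0≤ι d)) (0≤* (0≤ι 32) (0≤ι d))))
           (solve 2 (λ x d → con (ι 128) :* (x :* x) :* d
               :+ (con (ι 48) :* (d :* (x :* x :- d)) :+ (con (ι 16) :* (x :* x) :* d :+ con (ι 32) :* d))
               := con (ι 3) :* (con (ι 4) :* x :* (con (ι 4) :* x)) :* (con 0ℚ :* con 0ℚ :+ con (ι 4) :* d)
                  :- (con 0ℚ :* con 0ℚ :* (con 0ℚ :* con 0ℚ) :+ con (ι 24) :* d :* (con 0ℚ :* con 0ℚ)
                     :+ con (ι 48) :* (d :* d) :- con (ι 32) :* d)) refl x (ι d)) ⟩
    moments (ι 4 * x) (ι d) 0ℚ
      ≤⟨ moments≤meanAbs (0≤* (0≤ι 4) (0≤ι r)) d 0ℚ ⟩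
    ι 2 * (ι 4 * x * (ι 4 * x) * (ι 4 * x)) * meanAbs d 0ℚ
      ≡⟨ solve 2 (λ x f → con (ι 2) :* (con (ι 4) :* x :* (con (ι 4) :* x) :* (con (ι 4) :* x)) :* f
           := con (ι 128) :* (x :* x) :* (x :* f)) refl x (meanAbs d 0ℚ) ⟩
    ι 128 * (x * x) * (x * meanAbs d 0ℚ) ∎)
    where
    open ≤-Reasoning
    x = ι r
    128x²>0 : 0ℚ < ι 128 * (x * x)
    128x²>0 = <-≤-trans (positive⁻¹ (ι 128)) (≤-slack (ι 128 * ((x - 1ℚ) * (x + 1ℚ)))
      (0≤* (0≤ι 128) (0≤* (0≤-diff (ι-mono-≤ 1≤r)) (0≤+ (0≤ι r) (0≤ι 1))))
      (solve 1 (λ x → con (ι 128) :+ con (ι 128) :* ((x :- con 1ℚ) :* (x :+ con 1ℚ))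
         := con (ι 128) :* (x :* x)) refl x))

  -- Averaging over the signs of one side.

  ℕ-sum : ∀ {n} → (Fin n → ℕ) → ℕ
  ℕ-sum = ℕ∑.sum

  bit : Bool → ℕ
  bit b = if b then 1 else 0

  σ : Bool → ℚ
  σ b = if b then 1ℚ else - 1ℚ

  ι-sum : ∀ {n} (f : Fin n → ℕ) → ι (ℕ-sum f) ≡ sum (λ i → ι (f i))
  ι-sum {zero}  f = refl
  ι-sum {suc n} f = trans (ι-+ (f zero) _) (cong (ι (f zero) +_) (ι-sum (f ∘ suc)))

  -- Averaging over the signs y: a free coordinate is dropped by convexity of meanAbs,
  -- a forced one (b i j ≡ -2) is one step of the recursion defining meanAbs.
  sum-meanAbs≤ : ∀ {s p} (b : Fin p → Fin s → ℚ) (m : Fin p → Fin s → Bool) (v : Fin p → ℚ) M →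
    (∀ i j → T (m i j) → b i j ≡ - ι 2) →
    (∀ (y : Vec Bool s) → sum (λ i → ∣ v i + sum (λ j → b i j * σ (lookup y j)) ∣) ≤ M) →
    sum (λ i → meanAbs (ℕ-sum (λ j → bit (m i j))) (v i)) ≤ M
  sum-meanAbs≤ {zero} b m v M forced bound = begin
    sum (λ i → ∣ v i ∣)       ≡⟨ sum-cong-≗ (λ i → cong ∣_∣ (+-identityʳ (v i))) ⟨
    sum (λ i → ∣ v i + 0ℚ ∣)  ≤⟨ bound [] ⟩
    M                         ∎
    where open ≤-Reasoning
  sum-meanAbs≤ {suc s} {p} b m v M forced bound = begin
    sum (λ i → meanAbs (bit (m i zero) ℕ.+ d i) (v i))
      ≤⟨ sum-mono-≤ step ⟩
    sum (λ i → ½ * (meanAbs (d i) (v i + b i zero) + meanAbs (d i) (v i - b i zero)))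
      ≡⟨ *-distribˡ-sum ½ (λ i → meanAbs (d i) (v i + b i zero) + meanAbs (d i) (v i - b i zero)) ⟨
    ½ * sum (λ i → meanAbs (d i) (v i + b i zero) + meanAbs (d i) (v i - b i zero))
      ≡⟨ cong (½ *_) (∑-distrib-+ (λ i → meanAbs (d i) (v i + b i zero)) _) ⟩
    ½ * (sum (λ i → meanAbs (d i) (v i + b i zero)) + sum (λ i → meanAbs (d i) (v i - b i zero)))
      ≤⟨ *-monoˡ-≤-nonNeg ½ (+-mono-≤ (branch true (λ _ → *-identityʳ _))
           (branch false (λ i → solve 1 (λ b → b :* con (- 1ℚ) := :- b) refl (b i zero)))) ⟩
    ½ * (M + M)
      ≡⟨ solve 1 (λ M → con ½ :* (M :+ M) := M) refl M ⟩
    M ∎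
    where
    open ≤-Reasoning
    d : Fin p → ℕ
    d i = ℕ-sum (λ j → bit (m i (suc j)))
    step : ∀ i → meanAbs (bit (m i zero) ℕ.+ d i) (v i) ≤ ½ * (meanAbs (d i) (v i + b i zero) + meanAbs (d i) (v i - b i zero))
    step i with m i zero | forced i zero
    ... | false | _ = meanAbs-convex (d i) (v i) (b i zero)
    ... | true  | f rewrite f tt = ≤-reflexive
      (cong (½ *_) (+-comm (meanAbs (d i) (v i + ι 2)) (meanAbs (d i) (v i - ι 2))))
    -- Once the first sign is fixed, its term moves into the shift `v`, which is why the statement
    -- carries one. The bound `M` holds for every `y`, hence for both halves and for their mean.
    branch : ∀ c {q : Fin p → ℚ} → (∀ i → b i zero * σ c ≡ q i) → sum (λ i → meanAbs (d i) (v i + q i)) ≤ M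
    branch c {q} eq = sum-meanAbs≤ (λ i j → b i (suc j)) (λ i j → m i (suc j)) (λ i → v i + q i) M
      (λ i j → forced i (suc j))
      (λ y → subst (_≤ M) (sum-cong-≗ (λ i → cong ∣_∣
        (trans (sym (+-assoc (v i) (b i zero * σ c) _))
          (cong (λ x → v i + x + sum (λ j → b i (suc j) * σ (lookup y j))) (eq i)))))
        (bound (c ∷ y)))

  -- Cut values of a bipartitioned weight matrix.

  sum₂ : ∀ {m n} → (Fin m → Fin n → ℚ) → ℚ
  sum₂ f = sum λ i → sum (f i)

  sum₂-cong : ∀ {m n} {f g : Fin m → Fin n → ℚ} → (∀ i j → f i j ≡ g i j) → sum₂ f ≡ sum₂ g
  sum₂-cong f≡g = sum-cong-≗ (λ i → sum-cong-≗ (f≡g i))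

  sum₂-+ : ∀ {m n} (f g : Fin m → Fin n → ℚ) → sum₂ (λ i j → f i j + g i j) ≡ sum₂ f + sum₂ g
  sum₂-+ f g = trans (sum-cong-≗ (λ i → ∑-distrib-+ (f i) (g i))) (∑-distrib-+ _ (λ i → sum (g i)))

  crossing : ∀ {m n} → (Fin m → Fin n → ℚ) → Vec Bool m → Vec Bool n → Fin m → Fin n → ℚ
  crossing a z w i j = if lookup z i ∧ not (lookup w j) then a i j else 0ℚ

  block : ∀ {m n} → (Fin m → Fin n → ℚ) → Vec Bool m → Vec Bool n → ℚ
  block a z w = sum₂ (crossing a z w)

  cutValue : ∀ {n} → (Fin n → Fin n → ℚ) → Vec Bool n → ℚ
  cutValue a S = block a S S

  block-zero : ∀ {m n} {a : Fin m → Fin n → ℚ} → (∀ i j → a i j ≡ 0ℚ) → ∀ z w → block a z w ≡ 0ℚ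
  block-zero {a = a} a≡0 z w = sum-zero λ i → sum-zero λ j → vanish (lookup z i ∧ not (lookup w j)) (a≡0 i j)
    where
    vanish : ∀ c {q} → q ≡ 0ℚ → (if c then q else 0ℚ) ≡ 0ℚ
    vanish true  q≡0 = q≡0
    vanish false _   = refl

  module _ {m n : ℕ} (a : Fin m → Fin n → ℚ) (y : Vec Bool m) (x : Vec Bool n) where

    private
      ȳ = map not y
      x̄ = map not x

      different same : Fin m → Fin n → ℚ
      different i j = crossing a ȳ x i j + crossing a y x̄ i j
      same i j = crossing a y x i j + crossing a ȳ x̄ i j

    -- Each entry crosses exactly one of the four blocks: one of the two on the left if the signs of
    -- `i` and `j` agree, one of the two on the right if they differ. Their difference thus weights
    -- the entry by the product of the signs, and their sum, below, counts it once.
    block-alternate : block a ȳ x + block a y x̄ ≡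
      (block a y x + block a ȳ x̄) + sum₂ (λ i j → a i j * (σ (lookup y i) * σ (lookup x j)))
    block-alternate = begin
      block a ȳ x + block a y x̄
        ≡⟨ sum₂-+ (crossing a ȳ x) (crossing a y x̄) ⟨
      sum₂ different
        ≡⟨ sum₂-cong pointwise ⟩
      sum₂ (λ i j → same i j + signed i j)
        ≡⟨ sum₂-+ same signed ⟩
      sum₂ same + sum₂ signed
        ≡⟨ cong (_+ sum₂ signed) (sum₂-+ (crossing a y x) (crossing a ȳ x̄)) ⟩
      (block a y x + block a ȳ x̄) + sum₂ signed ∎
      where
      open ≡-Reasoning
      signed : Fin m → Fin n → ℚ
      signed i j = a i j * (σ (lookup y i) * σ (lookup x j))
      bools : ∀ y x q → (if not y ∧ not x then q else 0ℚ) + (if y ∧ not (not x) then q else 0ℚ) ≡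
        ((if y ∧ not x then q else 0ℚ) + (if not y ∧ not (not x) then q else 0ℚ)) + q * (σ y * σ x)
      bools true  true  = solve 1 (λ q → con 0ℚ :+ q := con 0ℚ :+ con 0ℚ :+ q :* (con 1ℚ :* con 1ℚ)) refl
      bools true  false = solve 1 (λ q → con 0ℚ :+ con 0ℚ := q :+ con 0ℚ :+ q :* (con 1ℚ :* con (- 1ℚ))) refl
      bools false true  = solve 1 (λ q → con 0ℚ :+ con 0ℚ := con 0ℚ :+ q :+ q :* (con (- 1ℚ) :* con 1ℚ)) refl
      bools false false = solve 1 (λ q → q :+ con 0ℚ := con 0ℚ :+ con 0ℚ :+ q :* (con (- 1ℚ) :* con (- 1ℚ))) refl
      pointwise : ∀ i j → different i j ≡ same i j + signed i j
      pointwise i j rewrite Vec.lookup-map i not y | Vec.lookup-map j not x =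
        bools (lookup y i) (lookup x j) (a i j)

    block-total : (block a ȳ x + block a y x̄) + (block a y x + block a ȳ x̄) ≡ sum₂ a
    block-total = begin
      (block a ȳ x + block a y x̄) + (block a y x + block a ȳ x̄)
        ≡⟨ cong₂ _+_ (sum₂-+ (crossing a ȳ x) (crossing a y x̄)) (sum₂-+ (crossing a y x) (crossing a ȳ x̄)) ⟨
      sum₂ different + sum₂ same
        ≡⟨ sum₂-+ different same ⟨
      sum₂ (λ i j → different i j + same i j)
        ≡⟨ sum₂-cong pointwise ⟩
      sum₂ a ∎
      where
      open ≡-Reasoning
      bools : ∀ y x q →
        ((if not y ∧ not x then q else 0ℚ) + (if y ∧ not (not x) then q else 0ℚ)) +
        ((if y ∧ not x then q else 0ℚ) + (if not y ∧ not (not x) then q else 0ℚ)) ≡ q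
      bools true  true  = solve 1 (λ q → con 0ℚ :+ q :+ (con 0ℚ :+ con 0ℚ) := q) refl
      bools true  false = solve 1 (λ q → con 0ℚ :+ con 0ℚ :+ (q :+ con 0ℚ) := q) refl
      bools false true  = solve 1 (λ q → con 0ℚ :+ con 0ℚ :+ (con 0ℚ :+ q) := q) refl
      bools false false = solve 1 (λ q → q :+ con 0ℚ :+ (con 0ℚ :+ con 0ℚ) := q) refl
      pointwise : ∀ i j → different i j + same i j ≡ a i j
      pointwise i j rewrite Vec.lookup-map i not y | Vec.lookup-map j not x =
        bools (lookup y i) (lookup x j) (a i j)

  module Bipartition {s p : ℕ} (a : Fin (s ℕ.+ p) → Fin (s ℕ.+ p) → ℚ) where

    LL : Fin s → Fin s → ℚ
    LL j j′ = a (j ↑ˡ p) (j′ ↑ˡ p)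

    LR : Fin s → Fin p → ℚ
    LR j i = a (j ↑ˡ p) (s ↑ʳ i)

    RL : Fin p → Fin s → ℚ
    RL i j = a (s ↑ʳ i) (j ↑ˡ p)

    RR : Fin p → Fin p → ℚ
    RR i i′ = a (s ↑ʳ i) (s ↑ʳ i′)

    cutValue-++ : ∀ y x → cutValue a (y ++ x) ≡ (block LL y y + block LR y x) + (block RL x y + block RR x x)
    cutValue-++ y x = trans (sum-↑² s _) (cong₂ _+_
      (cong₂ _+_ (sum₂-cong λ j j′ → cong₂ (cond (LL j j′)) (Vec.lookup-++ˡ y x j) (Vec.lookup-++ˡ y x j′))
                 (sum₂-cong λ j i → cong₂ (cond (LR j i)) (Vec.lookup-++ˡ y x j) (Vec.lookup-++ʳ y x i)))
      (cong₂ _+_ (sum₂-cong λ i j → cong₂ (cond (RL i j)) (Vec.lookup-++ʳ y x i) (Vec.lookup-++ˡ y x j))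
                 (sum₂-cong λ i i′ → cong₂ (cond (RR i i′)) (Vec.lookup-++ʳ y x i) (Vec.lookup-++ʳ y x i′))))
      where
      cond : ℚ → Bool → Bool → ℚ
      cond q z w = if z ∧ not w then q else 0ℚ

    row : Vec Bool s → Fin p → ℚ
    row y i = sum λ j → (RL i j + LR j i) * σ (lookup y j)

    row-pairing : ∀ y x →
      sum₂ (λ j i → LR j i * (σ (lookup y j) * σ (lookup x i))) +
      sum₂ (λ i j → RL i j * (σ (lookup x i) * σ (lookup y j))) ≡ sum (λ i → σ (lookup x i) * row y i)
    row-pairing y x = begin
      sum₂ (λ j i → LR j i * (σ (lookup y j) * σ (lookup x i))) + sum₂ RL′
        ≡⟨ cong (_+ sum₂ RL′) (∑-comm (λ j i → LR j i * (σ (lookup y j) * σ (lookup x i)))) ⟩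
      sum₂ (λ i j → LR j i * (σ (lookup y j) * σ (lookup x i))) + sum₂ RL′
        ≡⟨ sum₂-+ (λ i j → LR j i * (σ (lookup y j) * σ (lookup x i))) RL′ ⟨
      sum₂ (λ i j → LR j i * (σ (lookup y j) * σ (lookup x i)) + RL′ i j)
        ≡⟨ sum₂-cong (λ i j → solve 4 (λ l r y x → l :* (y :* x) :+ r :* (x :* y) := x :* ((r :+ l) :* y)) refl
             (LR j i) (RL i j) (σ (lookup y j)) (σ (lookup x i))) ⟩
      sum₂ (λ i j → σ (lookup x i) * ((RL i j + LR j i) * σ (lookup y j)))
        ≡⟨ sum-cong-≗ (λ i → *-distribˡ-sum (σ (lookup x i)) (λ j → (RL i j + LR j i) * σ (lookup y j))) ⟨
      sum (λ i → σ (lookup x i) * row y i) ∎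
      where
      open ≡-Reasoning
      RL′ : Fin p → Fin s → ℚ
      RL′ i j = RL i j * (σ (lookup x i) * σ (lookup y j))

    -- `LL` sees only the left signs and `RR` only the right ones, so both sides of the equation
    -- contain the same inner blocks: those of `y` and its negation, and those of `x` and its
    -- negation. They cancel whatever weights lie inside the two sides.
    cutValue-alternate : ∀ y x →
      cutValue a (map not y ++ x) + cutValue a (y ++ map not x) ≡
      (cutValue a (y ++ x) + cutValue a (map not y ++ map not x)) + sum (λ i → σ (lookup x i) * row y i)
    cutValue-alternate y x = begin
      cutValue a (ȳ ++ x) + cutValue a (y ++ x̄)
        ≡⟨ cong₂ _+_ (cutValue-++ ȳ x) (cutValue-++ y x̄) ⟩
      ((block LL ȳ ȳ + block LR ȳ x) + (block RL x ȳ + block RR x x)) +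
      ((block LL y y + block LR y x̄) + (block RL x̄ y + block RR x̄ x̄))
        ≡⟨ solve 8 (λ a b c d e f g h → ((a :+ b) :+ (c :+ d)) :+ ((e :+ f) :+ (g :+ h))
             := ((e :+ a) :+ (d :+ h)) :+ ((b :+ f) :+ (g :+ c))) refl
             (block LL ȳ ȳ) (block LR ȳ x) (block RL x ȳ) (block RR x x)
             (block LL y y) (block LR y x̄) (block RL x̄ y) (block RR x̄ x̄) ⟩
      ((block LL y y + block LL ȳ ȳ) + (block RR x x + block RR x̄ x̄)) +
      ((block LR ȳ x + block LR y x̄) + (block RL x̄ y + block RL x ȳ))
        ≡⟨ cong (((block LL y y + block LL ȳ ȳ) + (block RR x x + block RR x̄ x̄)) +_)
             (cong₂ _+_ (block-alternate LR y x) (block-alternate RL x y)) ⟩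
      ((block LL y y + block LL ȳ ȳ) + (block RR x x + block RR x̄ x̄)) +
      (((block LR y x + block LR ȳ x̄) + P) + ((block RL x y + block RL x̄ ȳ) + P′))
        ≡⟨ solve 10 (λ a b c d e f g h P P′ →
             ((a :+ b) :+ (c :+ d)) :+ (((e :+ f) :+ P) :+ ((g :+ h) :+ P′))
             := (((a :+ e) :+ (g :+ c)) :+ ((b :+ f) :+ (h :+ d))) :+ (P :+ P′)) refl
             (block LL y y) (block LL ȳ ȳ) (block RR x x) (block RR x̄ x̄)
             (block LR y x) (block LR ȳ x̄) (block RL x y) (block RL x̄ ȳ) P P′ ⟩
      (((block LL y y + block LR y x) + (block RL x y + block RR x x)) +
       ((block LL ȳ ȳ + block LR ȳ x̄) + (block RL x̄ ȳ + block RR x̄ x̄))) + (P + P′)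
        ≡⟨ cong₂ _+_ (cong₂ _+_ (cutValue-++ y x) (cutValue-++ ȳ x̄)) (sym (row-pairing y x)) ⟨
      (cutValue a (y ++ x) + cutValue a (ȳ ++ x̄)) + sum (λ i → σ (lookup x i) * row y i) ∎
      where
      open ≡-Reasoning
      ȳ = map not y
      x̄ = map not x
      P  = sum₂ (λ j i → LR j i * (σ (lookup y j) * σ (lookup x i)))
      P′ = sum₂ (λ i j → RL i j * (σ (lookup x i) * σ (lookup y j)))

    -- Applied to the biclique: the permitted error of each cut is proportional to its value, so the
    -- combined error is governed by this sum, in which each edge occurs twice.
    cutValue-total : (∀ j j′ → LL j j′ ≡ 0ℚ) → (∀ i i′ → RR i i′ ≡ 0ℚ) → ∀ y x →
      (cutValue a (map not y ++ x) + cutValue a (y ++ map not x)) +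
      (cutValue a (y ++ x) + cutValue a (map not y ++ map not x)) ≡ sum₂ LR + sum₂ RL
    cutValue-total LL≡0 RR≡0 y x = begin
      (cutValue a (ȳ ++ x) + cutValue a (y ++ x̄)) + (cutValue a (y ++ x) + cutValue a (ȳ ++ x̄))
        ≡⟨ cong₂ _+_ (cong₂ _+_ (bip ȳ x) (bip y x̄)) (cong₂ _+_ (bip y x) (bip ȳ x̄)) ⟩
      ((block LR ȳ x + block RL x ȳ) + (block LR y x̄ + block RL x̄ y)) +
      ((block LR y x + block RL x y) + (block LR ȳ x̄ + block RL x̄ ȳ))
        ≡⟨ solve 8 (λ a b c d e f g h → ((a :+ b) :+ (c :+ d)) :+ ((e :+ f) :+ (g :+ h))
             := ((a :+ c) :+ (e :+ g)) :+ ((d :+ b) :+ (f :+ h))) refl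
             (block LR ȳ x) (block RL x ȳ) (block LR y x̄) (block RL x̄ y)
             (block LR y x) (block RL x y) (block LR ȳ x̄) (block RL x̄ ȳ) ⟩
      ((block LR ȳ x + block LR y x̄) + (block LR y x + block LR ȳ x̄)) +
      ((block RL x̄ y + block RL x ȳ) + (block RL x y + block RL x̄ ȳ))
        ≡⟨ cong₂ _+_ (block-total LR y x) (block-total RL x y) ⟩
      sum₂ LR + sum₂ RL ∎
      where
      open ≡-Reasoning
      ȳ = map not y
      x̄ = map not x
      bip : ∀ y x → cutValue a (y ++ x) ≡ block LR y x + block RL x y
      bip y x = trans (cutValue-++ y x) (trans
        (cong₂ (λ l r → (l + block LR y x) + (block RL x y + r)) (block-zero LL≡0 y y) (block-zero RR≡0 x x))
        (solve 2 (λ l r → (con 0ℚ :+ l) :+ (r :+ con 0ℚ) := l :+ r) refl (block LR y x) (block RL x y)))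

  -- Cut errors of a sparsifier of a biclique.

  sign : ℚ → Bool
  sign q with ∣p∣≡p∨∣p∣≡-p q
  ... | inj₁ _ = true
  ... | inj₂ _ = false

  σ-sign : ∀ q → σ (sign q) * q ≡ ∣ q ∣
  σ-sign q with ∣p∣≡p∨∣p∣≡-p q
  ... | inj₁ ∣q∣≡q  = trans (*-identityˡ q) (sym ∣q∣≡q)
  ... | inj₂ ∣q∣≡-q = trans (solve 1 (λ q → con (- 1ℚ) :* q := :- q) refl q) (sym ∣q∣≡-q)

  -- The trace of `IsCutSparsifier` at a single index, where `η` is the slack that `≤` on reals
  -- allows.
  Approximates : ∀ {n} → ℚ → ℚ → (g h : Fin n → Fin n → ℚ) → Set
  Approximates ε η g h = ∀ S →
    (1ℚ - ε) * cutValue g S ≤ cutValue h S + η × cutValue h S ≤ (1ℚ + ε) * cutValue g S + η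

  record IsBiclique (s p : ℕ) (g : Fin (s ℕ.+ p) → Fin (s ℕ.+ p) → ℚ) : Set where
    open Bipartition {s} {p} g
    field
      LL≡0 : ∀ j j′ → LL j j′ ≡ 0ℚ
      LR≡1 : ∀ j i → LR j i ≡ 1ℚ
      RL≡1 : ∀ i j → RL i j ≡ 1ℚ
      RR≡0 : ∀ i i′ → RR i i′ ≡ 0ℚ

  -- For signs y and x on the two sides, the cuts of ±(-y , x) minus those
  -- of ±(y , x) isolate the terms of opposite sides; only symmetrised entries occur,
  -- so the weights of h need not be symmetric.
  module BicliqueSparsifier {s p : ℕ} {g h : Fin (s ℕ.+ p) → Fin (s ℕ.+ p) → ℚ} (biclique : IsBiclique s p g)
    {ε η : ℚ} (approx : Approximates ε η g h) where

    private
      module G = Bipartition {s} {p} g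
      module H = Bipartition {s} {p} h
    open IsBiclique biclique

    -- Both orientations of a unit edge together give 2. At a non-edge of `h` the excess is
    -- therefore exactly -2, the step size built into `meanAbs`.
    excess : Fin p → Fin s → ℚ
    excess i j = (H.RL i j + H.LR j i) - ι 2

    excessRow : Vec Bool s → Fin p → ℚ
    excessRow y i = sum λ j → excess i j * σ (lookup y j)

    sum-excessRow≤ : ∀ y x → sum (λ i → σ (lookup x i) * excessRow y i) ≤ ε * (ι 2 * (ι p * ι s)) + ι 4 * η
    sum-excessRow≤ y x = begin
      sum (λ i → σ (lookup x i) * excessRow y i)
        ≡⟨ solve 2 (λ a c → c := a :+ c :- a) refl
             (sum (λ i → σ (lookup x i) * G.row y i)) (sum (λ i → σ (lookup x i) * excessRow y i)) ⟩
      sum (λ i → σ (lookup x i) * G.row y i) + sum (λ i → σ (lookup x i) * excessRow y i)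
        - sum (λ i → σ (lookup x i) * G.row y i)
        ≡⟨ cong (_- sum (λ i → σ (lookup x i) * G.row y i)) row-split ⟨
      sum (λ i → σ (lookup x i) * H.row y i) - sum (λ i → σ (lookup x i) * G.row y i)
        ≡⟨ cong₂ _-_ (isolate (H.cutValue-alternate y x)) (isolate (G.cutValue-alternate y x)) ⟩
      ((h₁ + h₂) - (h₃ + h₄)) - ((g₁ + g₂) - (g₃ + g₄))
        -- The upper bounds serve the two cuts with positive sign and the lower bounds the two with
        -- negative sign, so each cut contributes `ε gᵢ + η`.
        ≤⟨ ≤-slack
             (((((1ℚ + ε) * g₁ + η) - h₁) + (((1ℚ + ε) * g₂ + η) - h₂)) +
              (((h₃ + η) - (1ℚ - ε) * g₃) + ((h₄ + η) - (1ℚ - ε) * g₄)))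
             (0≤+ (0≤+ (0≤-diff (proj₂ (approx (ȳ ++ x)))) (0≤-diff (proj₂ (approx (y ++ x̄)))))
                  (0≤+ (0≤-diff (proj₁ (approx (y ++ x)))) (0≤-diff (proj₁ (approx (ȳ ++ x̄))))))
             (solve 10 (λ ε η g₁ g₂ g₃ g₄ h₁ h₂ h₃ h₄ →
                ((h₁ :+ h₂) :- (h₃ :+ h₄)) :- ((g₁ :+ g₂) :- (g₃ :+ g₄)) :+
                (((((con 1ℚ :+ ε) :* g₁ :+ η) :- h₁) :+ (((con 1ℚ :+ ε) :* g₂ :+ η) :- h₂)) :+
                 (((h₃ :+ η) :- (con 1ℚ :- ε) :* g₃) :+ ((h₄ :+ η) :- (con 1ℚ :- ε) :* g₄)))
                := ε :* ((g₁ :+ g₂) :+ (g₃ :+ g₄)) :+ con (ι 4) :* η) refl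
                ε η g₁ g₂ g₃ g₄ h₁ h₂ h₃ h₄) ⟩
      ε * ((g₁ + g₂) + (g₃ + g₄)) + ι 4 * η
        ≡⟨ cong (λ w → ε * w + ι 4 * η) (trans (G.cutValue-total LL≡0 RR≡0 y x) total) ⟩
      ε * (ι 2 * (ι p * ι s)) + ι 4 * η ∎
      where
      open ≤-Reasoning
      ȳ = map not y
      x̄ = map not x
      h₁ = cutValue h (ȳ ++ x)
      h₂ = cutValue h (y ++ x̄)
      h₃ = cutValue h (y ++ x)
      h₄ = cutValue h (ȳ ++ x̄)
      g₁ = cutValue g (ȳ ++ x)
      g₂ = cutValue g (y ++ x̄)
      g₃ = cutValue g (y ++ x)
      g₄ = cutValue g (ȳ ++ x̄)
      isolate : ∀ {a b c} → a ≡ b + c → c ≡ a - b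
      isolate {b = b} {c} refl = solve 2 (λ b c → c := b :+ c :- b) refl b c
      row-split : sum (λ i → σ (lookup x i) * H.row y i) ≡
        sum (λ i → σ (lookup x i) * G.row y i) + sum (λ i → σ (lookup x i) * excessRow y i)
      row-split = trans (sum-cong-≗ (λ i → trans
          (cong (σ (lookup x i) *_) (trans
            (sum-cong-≗ (λ j → trans
              (solve 2 (λ a z → a :* z := con (ι 2) :* z :+ (a :- con (ι 2)) :* z) refl
                (H.RL i j + H.LR j i) (σ (lookup y j)))
              (cong (λ w → w * σ (lookup y j) + excess i j * σ (lookup y j))
                (sym (cong₂ _+_ (RL≡1 i j) (LR≡1 j i))))))
            (∑-distrib-+ (λ j → (G.RL i j + G.LR j i) * σ (lookup y j)) _)))
          (*-distribˡ-+ (σ (lookup x i)) (G.row y i) (excessRow y i))))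
        (∑-distrib-+ (λ i → σ (lookup x i) * G.row y i) _)
      total : sum₂ G.LR + sum₂ G.RL ≡ ι 2 * (ι p * ι s)
      total = trans
        (cong₂ _+_
          (trans (sum₂-cong LR≡1) (trans (sum-cong-≗ {s} (λ _ → sum-const p 1ℚ)) (sum-const s (ι p * 1ℚ))))
          (trans (sum₂-cong RL≡1) (trans (sum-cong-≗ {p} (λ _ → sum-const s 1ℚ)) (sum-const p (ι s * 1ℚ)))))
        (solve 2 (λ p s → s :* (p :* con 1ℚ) :+ p :* (s :* con 1ℚ) := con (ι 2) :* (p :* s)) refl (ι p) (ι s))

    sum-∣excessRow∣≤ : ∀ y → sum (λ i → ∣ excessRow y i ∣) ≤ ε * (ι 2 * (ι p * ι s)) + ι 4 * η
    sum-∣excessRow∣≤ y = begin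
      sum (λ i → ∣ excessRow y i ∣)
        ≡⟨ sum-cong-≗ (λ i → σ-sign (excessRow y i)) ⟨
      sum (λ i → σ (sign (excessRow y i)) * excessRow y i)
        ≡⟨ sum-cong-≗ (λ i → cong (λ b → σ b * excessRow y i) (Vec.lookup∘tabulate (λ i → sign (excessRow y i)) i)) ⟨
      sum (λ i → σ (lookup (tabulate (λ i → sign (excessRow y i))) i) * excessRow y i)
        ≤⟨ sum-excessRow≤ y (tabulate (λ i → sign (excessRow y i))) ⟩
      ε * (ι 2 * (ι p * ι s)) + ι 4 * η ∎
      where open ≤-Reasoning

    few-vanishing : ∀ {r u} → 1 ℕ.≤ r → s ≡ r ℕ.* r → 1 ℕ.≤ p → 0ℚ ≤ η → ε + ι 2 * η ≤ u → ι 4 * ι r * u ≤ 1ℚ →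
      (m : Fin p → Fin s → Bool) → (∀ i j → T (m i j) → H.RL i j + H.LR j i ≡ 0ℚ) →
      2 ℕ.* ℕ-sum (λ i → ℕ-sum (λ j → bit (m i j))) ℕ.≤ p ℕ.* s
    few-vanishing {r} {u} 1≤r s≡r² 1≤p 0≤η ε+2η≤u 4ru≤1 m vanish = ι-cancel-≤ (begin
      ι (2 ℕ.* ℕ-sum d)
        ≡⟨ trans (ι-* 2 (ℕ-sum d)) (cong (ι 2 *_) (ι-sum d)) ⟩
      ι 2 * sum (λ i → ι (d i))
        ≤⟨ *-monoˡ-≤-nonNeg (ι 2) (sum-mono-≤ (λ i → meanAbs-lower r (d i) 1≤r (subst (d i ℕ.≤_) s≡r² (d≤s (m i))))) ⟩
      ι 2 * sum (λ i → ι r * meanAbs (d i) 0ℚ)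
        ≡⟨ cong (ι 2 *_) (*-distribˡ-sum (ι r) (λ i → meanAbs (d i) 0ℚ)) ⟨
      ι 2 * (ι r * sum (λ i → meanAbs (d i) 0ℚ))
        ≤⟨ *-monoˡ-≤-nonNeg (ι 2) (*-monoˡ-≤-nonNeg (ι r) {{nonNegative (0≤ι r)}}
             (sum-meanAbs≤ excess m (λ _ → 0ℚ) _ forced (λ y →
               ≤-trans (≤-reflexive (sum-cong-≗ (λ i → cong ∣_∣ (+-identityˡ (excessRow y i)))))
                 (sum-∣excessRow∣≤ y)))) ⟩
      ι 2 * (ι r * (ε * (ι 2 * W) + ι 4 * η))
        -- As `W ≥ 1`, the additive term `8 r η` is at most `8 r η W`. The whole is then at most
        -- `4 r (ε + 2 η) W ≤ 4 r u W ≤ W`.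
        ≤⟨ ≤-slack (ι 2 * (ι r * (ι 2 * W * (u - (ε + ι 2 * η)) + ι 4 * (η * (W - 1ℚ)))) + W * (1ℚ - ι 4 * ι r * u))
             (0≤+ (0≤* (0≤ι 2) (0≤* (0≤ι r) (0≤+ (0≤* (0≤* (0≤ι 2) 0≤W) (0≤-diff ε+2η≤u))
                      (0≤* (0≤ι 4) (0≤* 0≤η (0≤-diff 1≤W))))))
                  (0≤* 0≤W (0≤-diff 4ru≤1)))
             (solve 5 (λ r ε W η u →
                con (ι 2) :* (r :* (ε :* (con (ι 2) :* W) :+ con (ι 4) :* η)) :+
                (con (ι 2) :* (r :* (con (ι 2) :* W :* (u :- (ε :+ con (ι 2) :* η))
                   :+ con (ι 4) :* (η :* (W :- con 1ℚ)))) :+ W :* (con 1ℚ :- con (ι 4) :* r :* u))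
                := W) refl (ι r) ε W η u) ⟩
      W
        ≡⟨ ι-* p s ⟨
      ι (p ℕ.* s) ∎)
      where
      open ≤-Reasoning
      W = ι p * ι s
      d : Fin p → ℕ
      d i = ℕ-sum (λ j → bit (m i j))
      d≤s : ∀ {n} (f : Fin n → Bool) → ℕ-sum (λ j → bit (f j)) ℕ.≤ n
      d≤s {zero}  f = ℕ.z≤n
      d≤s {suc n} f with f zero
      ... | true  = ℕ.s≤s (d≤s (f ∘ suc))
      ... | false = ℕ.m≤n⇒m≤1+n (d≤s (f ∘ suc))
      forced : ∀ i j → T (m i j) → excess i j ≡ - ι 2
      forced i j t = trans (cong (_- ι 2) (vanish i j t)) (+-identityˡ (- ι 2))
      0≤W : 0ℚ ≤ W
      0≤W = 0≤* (0≤ι p) (0≤ι s)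
      1≤W : 1ℚ ≤ W
      1≤W = subst (1ℚ ≤_) (ι-* p s) (ι-mono-≤ {1} {p ℕ.* s}
        (ℕ.*-mono-≤ 1≤p (subst (1 ℕ.≤_) (sym s≡r²) (ℕ.*-mono-≤ 1≤r 1≤r))))

  -- Cuts around a single vertex.

  singleton : ∀ {n} → Fin n → Vec Bool n
  singleton i = tabulate (λ k → does (k Fin.≟ i))

  cutValue-singleton-zero : ∀ {n} (a : Fin n → Fin n → ℚ) i → (∀ j → a i j ≡ 0ℚ) → cutValue a (singleton i) ≡ 0ℚ
  cutValue-singleton-zero a i aᵢ≡0 = sum-zero λ k → sum-zero λ j → vanish k j
    where
    vanish : ∀ k j → crossing a (singleton i) (singleton i) k j ≡ 0ℚ
    vanish k j rewrite Vec.lookup∘tabulate (λ k → does (k Fin.≟ i)) k with k Fin.≟ i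
    ... | no _ = refl
    ... | yes refl with not (lookup (singleton i) j)
    ...   | true  = aᵢ≡0 j
    ...   | false = refl

  entry≤cutValue-singleton : ∀ {n} (a : Fin n → Fin n → ℚ) → (∀ i j → 0ℚ ≤ a i j) → ∀ {i j} → ¬ (j ≡ i) →
    a i j ≤ cutValue a (singleton i)
  entry≤cutValue-singleton a 0≤a {i} {j} j≢i = begin
    a i j
      ≡⟨ entry ⟨
    crossing a (singleton i) (singleton i) i j
      ≤⟨ term≤sum (0≤crossing i) j ⟩
    sum (crossing a (singleton i) (singleton i) i)
      ≤⟨ term≤sum (λ k → sum-nonNeg (0≤crossing k)) i ⟩
    cutValue a (singleton i) ∎
    where
    open ≤-Reasoning
    0≤crossing : ∀ k l → 0ℚ ≤ crossing a (singleton i) (singleton i) k l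
    0≤crossing k l with lookup (singleton i) k ∧ not (lookup (singleton i) l)
    ... | true  = 0≤a k l
    ... | false = ≤-refl
    entry : crossing a (singleton i) (singleton i) i j ≡ a i j
    entry rewrite Vec.lookup∘tabulate (λ k → does (k Fin.≟ i)) i
                | Vec.lookup∘tabulate (λ k → does (k Fin.≟ i)) j
                | dec-true (i Fin.≟ i) refl | dec-false (j Fin.≟ i) j≢i = refl

  -- The constant and the choice of `r`.

  c₀ : ℚ
  c₀ = ℤ.+ 1 / 1024

  -- Source of the constant, `1024 = 4 * 16²`: from `1 ≤ 16 r x` follows `n ≤ 256 n r² x²`, and
  -- `n r² ≤ 4 e` turns this into `1024 e x²`.
  density-bound : ∀ {x} r n e → 0ℚ ≤ x → 1ℚ ≤ ι 16 * ι r * x → n ℕ.* (r ℕ.* r) ℕ.≤ 4 ℕ.* e →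
    c₀ * ι n ≤ ι e * (x * x)
  density-bound {x} r n e 0≤x 1≤16rx nr²≤4e = *-cancelˡ-≤ (ι 1024) (positive⁻¹ (ι 1024)) (begin
    ι 1024 * (c₀ * ι n)    ≡⟨ *-assoc (ι 1024) c₀ (ι n) ⟨
    ι 1024 * c₀ * ι n      ≡⟨ *-identityˡ (ι n) ⟩
    ι n
      ≤⟨ ≤-slack
           (ι 256 * (x * x) * (ι 4 * ι e - ι n * (ι r * ι r)) +
            ι n * ((ι 16 * ι r * x - 1ℚ) * (ι 16 * ι r * x + 1ℚ)))
           (0≤+ (0≤* (0≤* (0≤ι 256) (0≤square x))
                  (0≤-diff (subst₂ _≤_ (trans (ι-* n (r ℕ.* r)) (cong (ι n *_) (ι-* r r))) (ι-* 4 e)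
                    (ι-mono-≤ nr²≤4e))))
                (0≤* (0≤ι n) (0≤* (0≤-diff 1≤16rx)
                  (0≤+ (0≤* (0≤* (0≤ι 16) (0≤ι r)) 0≤x) (0≤ι 1)))))
           (solve 4 (λ x r n e → n :+
             (con (ι 256) :* (x :* x) :* (con (ι 4) :* e :- n :* (r :* r)) :+
              n :* ((con (ι 16) :* r :* x :- con 1ℚ) :* (con (ι 16) :* r :* x :+ con 1ℚ)))
             := con (ι 1024) :* (e :* (x :* x))) refl x (ι r) (ι n) (ι e)) ⟩
    ι 1024 * (ι e * (x * x)) ∎)
    where open ≤-Reasoning

  size>1 : ∀ {x} n → 0ℚ ≤ x → x ≤ 1ℚ → 1ℚ < x * x * ι n → 2 ℕ.≤ n
  size>1 {x} n 0≤x x≤1 1<x²n = ℕ.≰⇒> λ n≤1 → <-irrefl refl (begin-strict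
    1ℚ            <⟨ 1<x²n ⟩
    x * x * ι n   ≤⟨ ≤-slack (ι n * ((1ℚ - x) * (1ℚ + x)))
                       (0≤* (0≤ι n) (0≤* (0≤-diff x≤1) (0≤+ (0≤ι 1) 0≤x)))
                       (solve 2 (λ x n → x :* x :* n :+ n :* ((con 1ℚ :- x) :* (con 1ℚ :+ x)) := n) refl x (ι n)) ⟩
    ι n           ≤⟨ ι-mono-≤ n≤1 ⟩
    1ℚ            ∎)
    where open ≤-Reasoning

  -- Here `ε > 1/√n` makes room for the small side: `4 r x ≤ 4 r u ≤ 1` gives `16 r² x² ≤ 1 < x² n`.
  size>16r² : ∀ {x u} r n → 0ℚ ≤ x → x ≤ u → 1ℚ < x * x * ι n → ι 4 * ι r * u ≤ 1ℚ → 16 ℕ.* (r ℕ.* r) ℕ.≤ n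
  size>16r² {x} {u} r n 0≤x x≤u 1<x²n 4ru≤1 = ℕ.≮⇒≥ λ n<16r² → <-irrefl refl (begin-strict
    1ℚ                                  <⟨ 1<x²n ⟩
    x * x * ι n                         ≤⟨ *-monoˡ-≤-nonNeg (x * x) {{nonNegative (0≤square x)}} (ι-mono-≤ (ℕ.<⇒≤ n<16r²)) ⟩
    x * x * ι (16 ℕ.* (r ℕ.* r))        ≡⟨ cong (x * x *_) (trans (ι-* 16 (r ℕ.* r)) (cong (ι 16 *_) (ι-* r r))) ⟩
    x * x * (ι 16 * (ι r * ι r))
      ≤⟨ ≤-slack (ι 16 * (ι r * ι r) * ((u - x) * (u + x)) + (1ℚ - ι 4 * ι r * u) * (1ℚ + ι 4 * ι r * u))
           (0≤+ (0≤* (0≤* (0≤ι 16) (0≤square (ι r))) (0≤* (0≤-diff x≤u) (0≤+ 0≤u 0≤x)))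
                (0≤* (0≤-diff 4ru≤1) (0≤+ (0≤ι 1) (0≤* (0≤* (0≤ι 4) (0≤ι r)) 0≤u))))
           (solve 3 (λ x u r → x :* x :* (con (ι 16) :* (r :* r)) :+
             (con (ι 16) :* (r :* r) :* ((u :- x) :* (u :+ x)) :+
              (con 1ℚ :- con (ι 4) :* r :* u) :* (con 1ℚ :+ con (ι 4) :* r :* u)) := con 1ℚ) refl x u (ι r)) ⟩
    1ℚ ∎)
    where
    open ≤-Reasoning
    0≤u : 0ℚ ≤ u
    0≤u = ≤-trans 0≤x x≤u

  maximal-below : {P : ℕ → Set} → (∀ k → Dec (P k)) → P 1 → ∀ k → ¬ P (suc k) →
    ∃[ r ] 1 ℕ.≤ r × P r × ¬ P (suc r)
  maximal-below P? P1 zero    ¬P = ⊥-elim (¬P P1)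
  maximal-below P? P1 (suc k) ¬P with P? (suc k)
  ... | yes Pk = suc k , ℕ.s≤s ℕ.z≤n , Pk , ¬P
  ... | no ¬Pk = maximal-below P? P1 k ¬Pk

  -- The number r is chosen so that r² ≈ 1 / (16 u²).
  choose-side : ∀ {x u} n → 0ℚ ≤ x → x ≤ 1ℚ → x ≤ u → 1ℚ < x * x * ι n → ι 4 * ι 1 * u ≤ 1ℚ →
    ∃[ r ] 1 ℕ.≤ r × ι 4 * ι r * u ≤ 1ℚ × 1ℚ ≤ ι 8 * ι r * u
  choose-side {x} {u} n 0≤x x≤1 x≤u 1<x²n small₁ = rescale (maximal-below {Small} small? small₁ n ¬small)
    where
    open ≤-Reasoning
    0≤u : 0ℚ ≤ u
    0≤u = ≤-trans 0≤x x≤u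
    Small : ℕ → Set
    Small k = ι 4 * ι k * u ≤ 1ℚ
    small? : ∀ k → Dec (Small k)
    small? k = ι 4 * ι k * u ≤? 1ℚ
    ¬small : ¬ Small (suc n)
    -- The search may start at `n`: otherwise `x² n ≤ x n ≤ 4 (n + 1) u ≤ 1`, against `1 < x² n`.
    ¬small small = <-irrefl refl (begin-strict
      1ℚ            <⟨ 1<x²n ⟩
      x * x * ι n
        ≤⟨ ≤-slack (ι 4 * u + (ι 4 * (ι n * (u - x)) + (ι 3 * (ι n * x) + ι n * (x * (1ℚ - x)))))
             (0≤+ (0≤* (0≤ι 4) 0≤u) (0≤+ (0≤* (0≤ι 4) (0≤* (0≤ι n) (0≤-diff x≤u)))
               (0≤+ (0≤* (0≤ι 3) (0≤* (0≤ι n) 0≤x)) (0≤* (0≤ι n) (0≤* 0≤x (0≤-diff x≤1))))))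
             (solve 3 (λ x u n → x :* x :* n :+ (con (ι 4) :* u :+ (con (ι 4) :* (n :* (u :- x)) :+
               (con (ι 3) :* (n :* x) :+ n :* (x :* (con 1ℚ :- x))))) := con (ι 4) :* (con 1ℚ :+ n) :* u)
               refl x u (ι n)) ⟩
      ι 4 * (1ℚ + ι n) * u   ≡⟨ cong (λ z → ι 4 * z * u) (ι-+ 1 n) ⟨
      ι 4 * ι (suc n) * u    ≤⟨ small ⟩
      1ℚ                     ∎)
    rescale : (∃[ r ] 1 ℕ.≤ r × Small r × ¬ Small (suc r)) →
      ∃[ r ] 1 ℕ.≤ r × Small r × 1ℚ ≤ ι 8 * ι r * u
    -- Maximality says that `r + 1` is too large, and `r + 1 ≤ 2 r` converts the factor 4 into 8.
    rescale (r , 1≤r , small , ¬smaller) = r , 1≤r , small , (begin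
      1ℚ                      ≤⟨ <⇒≤ (≰⇒> ¬smaller) ⟩
      ι 4 * ι (suc r) * u     ≡⟨ cong (λ z → ι 4 * z * u) (ι-+ 1 r) ⟩
      ι 4 * (1ℚ + ι r) * u
        ≤⟨ ≤-slack (ι 4 * u * (ι r - 1ℚ)) (0≤* (0≤* (0≤ι 4) 0≤u) (0≤-diff (ι-mono-≤ {1} {r} 1≤r)))
             (solve 2 (λ r u → con (ι 4) :* (con 1ℚ :+ r) :* u :+ con (ι 4) :* u :* (r :- con 1ℚ)
               := con (ι 8) :* r :* u) refl (ι r) u) ⟩
      ι 8 * ι r * u           ∎)

open import Defs
open RationalInequalities

-- Counting edges.

ℕ-sum-mono : ∀ {n} {f g : Fin n → ℕ} → (∀ i → f i ℕ.≤ g i) → ℕ-sum f ℕ.≤ ℕ-sum g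
ℕ-sum-mono {zero}  f≤g = ℕ.z≤n
ℕ-sum-mono {suc n} f≤g = ℕ.+-mono-≤ (f≤g zero) (ℕ-sum-mono (f≤g ∘ suc))

term≤ℕ-sum : ∀ {n} (f : Fin n → ℕ) k → f k ℕ.≤ ℕ-sum f
term≤ℕ-sum f zero    = ℕ.m≤m+n (f zero) _
term≤ℕ-sum f (suc k) = ℕ.≤-trans (term≤ℕ-sum (f ∘ suc) k) (ℕ.m≤n+m _ (f zero))

ℕ-sum-const : ∀ n c → ℕ-sum {n} (λ _ → c) ≡ n ℕ.* c
ℕ-sum-const zero    c = refl
ℕ-sum-const (suc n) c = cong (c ℕ.+_) (ℕ-sum-const n c)

ℕ-sum-↑ˡ : ∀ {s p} (f : Fin (s ℕ.+ p) → ℕ) → ℕ-sum (λ j → f (j ↑ˡ p)) ℕ.≤ ℕ-sum f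
ℕ-sum-↑ˡ {zero}  f = ℕ.z≤n
ℕ-sum-↑ˡ {suc s} f = ℕ.+-monoʳ-≤ (f zero) (ℕ-sum-↑ˡ {s} (f ∘ suc))

ℕ-sum-↑ʳ : ∀ s {p} (f : Fin (s ℕ.+ p) → ℕ) → ℕ-sum (λ i → f (s ↑ʳ i)) ℕ.≤ ℕ-sum f
ℕ-sum-↑ʳ zero    f = ℕ.≤-refl
ℕ-sum-↑ʳ (suc s) f = ℕ.≤-trans (ℕ-sum-↑ʳ s (f ∘ suc)) (ℕ.m≤n+m _ (f zero))

length-filter-tabulate : ∀ {A : Set} {P : A → Set} (P? : Decidable P) {n} (f : Fin n → A) →
  length (filter P? (List.tabulate f)) ≡ ℕ-sum (λ i → bit (does (P? (f i))))
length-filter-tabulate P? {zero}  f = refl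
length-filter-tabulate P? {suc n} f with does (P? (f zero))
... | true  = cong suc (length-filter-tabulate P? (f ∘ suc))
... | false = length-filter-tabulate P? (f ∘ suc)

length-filter-cartesianProduct : ∀ {A B : Set} {P : A × B → Set} (P? : Decidable P)
  {m n} (f : Fin m → A) (g : Fin n → B) →
  length (filter P? (cartesianProduct (List.tabulate f) (List.tabulate g))) ≡
  ℕ-sum (λ i → ℕ-sum (λ j → bit (does (P? (f i , g j)))))
length-filter-cartesianProduct P? {zero}  f g = refl
length-filter-cartesianProduct P? {suc m} f g = begin
  length (filter P? (List.map (f zero ,_) (List.tabulate g) List.++ rest))
    ≡⟨ cong length (List.filter-++ P? (List.map (f zero ,_) (List.tabulate g)) rest) ⟩
  length (filter P? (List.map (f zero ,_) (List.tabulate g)) List.++ filter P? rest)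
    ≡⟨ List.length-++ (filter P? (List.map (f zero ,_) (List.tabulate g))) ⟩
  length (filter P? (List.map (f zero ,_) (List.tabulate g))) ℕ.+ length (filter P? rest)
    ≡⟨ cong₂ ℕ._+_
         (trans (cong (λ l → length (filter P? l)) (List.map-tabulate g (f zero ,_)))
           (length-filter-tabulate P? (λ j → f zero , g j)))
         (length-filter-cartesianProduct P? (f ∘ suc) g) ⟩
  _ ∎
  where
  open ≡-Reasoning
  rest = cartesianProduct (List.tabulate (f ∘ suc)) (List.tabulate g)

isEdge : ∀ {n} → Graph n → Fin n → Fin n → Bool
isEdge H i j = does (i Fin.<? j) ∧ adj H i j

numEdges≡sum : ∀ {n} (H : Graph n) → numEdges H ≡ ℕ-sum (λ i → ℕ-sum (λ j → bit (isEdge H i j)))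
numEdges≡sum {n} H = length-filter-cartesianProduct _ {n} {n} (λ i → i) (λ j → j)

nonEdge : ∀ {s p} → Graph (s ℕ.+ p) → Fin p → Fin s → Bool
nonEdge {s} {p} H i j = not (adj H (j ↑ˡ p) (s ↑ʳ i))

-- The small side is numbered first, so a cross pair written left to right already has the
-- orientation in which edges are listed. Edges of `H` inside a side can only help the inequality.
pairs≤nonEdges+numEdges : ∀ {s p} (H : Graph (s ℕ.+ p)) →
  p ℕ.* s ℕ.≤ ℕ-sum (λ i → ℕ-sum (λ j → bit (nonEdge {s} H i j))) ℕ.+ numEdges H
pairs≤nonEdges+numEdges {s} {p} H = begin
  p ℕ.* s
    ≡⟨ ℕ-sum-const p s ⟨
  ℕ-sum {p} (λ _ → s)
    ≡⟨ ℕ∑.sum-cong-≗ {p} (λ i → trans (ℕ-sum-const s 1) (ℕ.*-identityʳ s)) ⟨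
  ℕ-sum {p} (λ _ → ℕ-sum {s} (λ _ → 1))
    ≡⟨ ℕ∑.sum-cong-≗ {p} (λ i → ℕ∑.sum-cong-≗ {s} (λ j → split (adj H (j ↑ˡ p) (s ↑ʳ i)))) ⟨
  ℕ-sum (λ i → ℕ-sum (λ j → non i j ℕ.+ edge j i))
    ≡⟨ ℕ∑.sum-cong-≗ (λ i → ℕ∑.∑-distrib-+ (non i) (λ j → edge j i)) ⟩
  ℕ-sum (λ i → ℕ-sum (non i) ℕ.+ ℕ-sum (λ j → edge j i))
    ≡⟨ ℕ∑.∑-distrib-+ (λ i → ℕ-sum (non i)) (λ i → ℕ-sum (λ j → edge j i)) ⟩
  ℕ-sum (λ i → ℕ-sum (non i)) ℕ.+ ℕ-sum (λ i → ℕ-sum (λ j → edge j i))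
    ≡⟨ cong (ℕ-sum (λ i → ℕ-sum (non i)) ℕ.+_) (ℕ∑.∑-comm edge) ⟨
  ℕ-sum (λ i → ℕ-sum (non i)) ℕ.+ ℕ-sum (λ j → ℕ-sum (edge j))
    ≤⟨ ℕ.+-monoʳ-≤ (ℕ-sum (λ i → ℕ-sum (non i))) (begin
      ℕ-sum (λ j → ℕ-sum (edge j))
        ≡⟨ ℕ∑.sum-cong-≗ (λ j → ℕ∑.sum-cong-≗ (λ i → cong (λ b → bit (b ∧ adj H (j ↑ˡ p) (s ↑ʳ i)))
             (dec-true ((j ↑ˡ p) Fin.<? (s ↑ʳ i)) (↑ˡ<↑ʳ j i)))) ⟨
      ℕ-sum (λ j → ℕ-sum (λ i → bit (isEdge H (j ↑ˡ p) (s ↑ʳ i))))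
        ≤⟨ ℕ-sum-mono (λ j → ℕ-sum-↑ʳ s (λ l → bit (isEdge H (j ↑ˡ p) l))) ⟩
      ℕ-sum (λ j → ℕ-sum (λ l → bit (isEdge H (j ↑ˡ p) l)))
        ≤⟨ ℕ-sum-↑ˡ {s} (λ k → ℕ-sum (λ l → bit (isEdge H k l))) ⟩
      ℕ-sum (λ k → ℕ-sum (λ l → bit (isEdge H k l)))
        ≡⟨ numEdges≡sum H ⟨
      numEdges H ∎) ⟩
  ℕ-sum (λ i → ℕ-sum (non i)) ℕ.+ numEdges H ∎
  where
  open ℕ.≤-Reasoning
  non : Fin p → Fin s → ℕ
  non i j = bit (nonEdge {s} H i j)
  edge : Fin s → Fin p → ℕ
  edge j i = bit (adj H (j ↑ˡ p) (s ↑ʳ i))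
  split : ∀ b → bit (not b) ℕ.+ bit b ≡ 1
  split true  = refl
  split false = refl
  ↑ˡ<↑ʳ : ∀ (j : Fin s) (i : Fin p) → toℕ (j ↑ˡ p) ℕ.< toℕ (s ↑ʳ i)
  ↑ˡ<↑ʳ j i = subst₂ ℕ._<_ (sym (Fin.toℕ-↑ˡ j p)) (sym (Fin.toℕ-↑ʳ s i))
    (ℕ.≤-trans (Fin.toℕ<n j) (ℕ.m≤m+n s (toℕ i)))

-- The handshake argument: the degrees sum to twice the number of edges. The factor 2 allows for one
-- edge of `H` that joins two of the covered vertices.
covered≤2*numEdges : ∀ {s p} (H : Graph (s ℕ.+ p)) → (∀ i → ∃[ j ] T (adj H (s ↑ʳ i) j)) → p ℕ.≤ 2 ℕ.* numEdges H
covered≤2*numEdges {s} {p} H neighbour = begin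
  p
    ≡⟨ trans (ℕ-sum-const p 1) (ℕ.*-identityʳ p) ⟨
  ℕ-sum {p} (λ _ → 1)
    ≤⟨ ℕ-sum-mono (λ i → ℕ.≤-trans (T⇒1≤bit (proj₂ (neighbour i)))
         (term≤ℕ-sum (λ j → bit (adj H (s ↑ʳ i) j)) (proj₁ (neighbour i)))) ⟩
  ℕ-sum (λ i → ℕ-sum (λ j → bit (adj H (s ↑ʳ i) j)))
    ≤⟨ ℕ-sum-↑ʳ s (λ k → ℕ-sum (λ l → bit (adj H k l))) ⟩
  ℕ-sum (λ k → ℕ-sum (λ l → bit (adj H k l)))
    ≤⟨ ℕ-sum-mono (λ k → ℕ-sum-mono (λ l → oriented k l)) ⟩
  ℕ-sum (λ k → ℕ-sum (λ l → edge k l ℕ.+ edge l k))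
    ≡⟨ ℕ∑.sum-cong-≗ (λ k → ℕ∑.∑-distrib-+ (edge k) (λ l → edge l k)) ⟩
  ℕ-sum (λ k → ℕ-sum (edge k) ℕ.+ ℕ-sum (λ l → edge l k))
    ≡⟨ ℕ∑.∑-distrib-+ (λ k → ℕ-sum (edge k)) (λ k → ℕ-sum (λ l → edge l k)) ⟩
  ℕ-sum (λ k → ℕ-sum (edge k)) ℕ.+ ℕ-sum (λ k → ℕ-sum (λ l → edge l k))
    ≡⟨ cong (ℕ-sum (λ k → ℕ-sum (edge k)) ℕ.+_) (ℕ∑.∑-comm edge) ⟨
  ℕ-sum (λ k → ℕ-sum (edge k)) ℕ.+ ℕ-sum (λ k → ℕ-sum (edge k))
    ≡⟨ cong₂ ℕ._+_ (numEdges≡sum H) (trans (ℕ.+-identityʳ (numEdges H)) (numEdges≡sum H)) ⟨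
  2 ℕ.* numEdges H ∎
  where
  open ℕ.≤-Reasoning
  edge : Fin (s ℕ.+ p) → Fin (s ℕ.+ p) → ℕ
  edge k l = bit (isEdge H k l)
  T⇒1≤bit : ∀ {b} → T b → 1 ℕ.≤ bit b
  T⇒1≤bit {true} _ = ℕ.s≤s ℕ.z≤n
  bit-mono : ∀ {b c} → (T b → T c) → bit b ℕ.≤ bit c
  bit-mono {false}         _ = ℕ.z≤n
  bit-mono {true}  {true}  _ = ℕ.≤-refl
  bit-mono {true}  {false} f = ⊥-elim (f tt)
  oriented : ∀ k l → bit (adj H k l) ℕ.≤ edge k l ℕ.+ edge l k
  oriented k l with Fin.<-cmp k l
  ... | tri< k<l _ _ rewrite dec-true (k Fin.<? l) k<l = ℕ.m≤m+n _ _
  ... | tri≈ _ refl _ = ℕ.≤-trans (bit-mono {adj H k k} {false} (adj-irrefl H k)) ℕ.z≤n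
  ... | tri> _ _ l<k rewrite dec-true (l Fin.<? k) l<k =
    ℕ.≤-trans (bit-mono (adj-sym H k l)) (ℕ.m≤n+m _ (edge k l))

-- From real cut weights to rational ones at one index.

Eventually : (ℕ → Set) → Set
Eventually P = ∃[ N ] (∀ m → N ℕ.≤ m → P m)

eventually-map : ∀ {P Q : ℕ → Set} → (∀ m → P m → Q m) → Eventually P → Eventually Q
eventually-map f (N , p) = N , λ m N≤m → f m (p m N≤m)

eventually-× : ∀ {P Q : ℕ → Set} → Eventually P → Eventually Q → Eventually (λ m → P m × Q m)
eventually-× (M , p) (N , q) = M ℕ.⊔ N , λ m M⊔N≤m →
  p m (ℕ.m⊔n≤o⇒m≤o M N M⊔N≤m) , q m (ℕ.m⊔n≤o⇒n≤o M N M⊔N≤m)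

-- There are only finitely many subsets, so their thresholds can be merged; this is what makes one
-- index valid for all cuts at once.
eventually-∀Subset : ∀ {n} {P : Subset n → ℕ → Set} → (∀ S → Eventually (P S)) → Eventually (λ m → ∀ S → P S m)
eventually-∀Subset {zero}  p = eventually-map (λ { m q [] → q }) (p [])
eventually-∀Subset {suc n} p =
  eventually-map (λ { m (q , r) (true ∷ S) → q S ; m (q , r) (false ∷ S) → r S })
    (eventually-× (eventually-∀Subset (λ S → p (true ∷ S))) (eventually-∀Subset (λ S → p (false ∷ S))))

eventually-witness : ∀ {P : ℕ → Set} → Eventually P → ∃[ m ] P m
eventually-witness (N , p) = N , p N ℕ.≤-refl

-- Masked by adjacency because `weight` is arbitrary off the edges, whereas the argument rests on
-- exact zeros there.
weights : ∀ {n} → Graph n → ℕ → Fin n → Fin n → ℚ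
weights G m i j = if adj G i j then seq (weight G i j) m else 0ℚ

seq-∑ : ∀ {n} (f : Fin n → ℝ) m → seq (∑ f) m ≡ sum (λ i → seq (f i) m)
seq-∑ {zero}  f m = refl
seq-∑ {suc n} f m = cong (seq (f zero) m ℚ.+_) (seq-∑ (f ∘ suc) m)

seq-cutWeight : ∀ {n} (G : Graph n) S m → seq (cutWeight G S) m ≡ cutValue (weights G m) S
seq-cutWeight {n} G S m = trans
  (seq-∑ (λ i → ∑ λ j → if lookup S i ∧ not (lookup S j) ∧ adj G i j then weight G i j else 0ℝ) m)
  (sum-cong-≗ λ i → trans
    (seq-∑ (λ j → if lookup S i ∧ not (lookup S j) ∧ adj G i j then weight G i j else 0ℝ) m)
    (sum-cong-≗ λ j → entry (lookup S i) (not (lookup S j)) (adj G i j) (weight G i j)))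
  where
  entry : ∀ a b c x → seq (if a ∧ b ∧ c then x else 0ℝ) m ≡ (if a ∧ b then (if c then seq x m else 0ℚ) else 0ℚ)
  entry false b     c     x = refl
  entry true  false c     x = refl
  entry true  true  true  x = refl
  entry true  true  false x = refl

sparsifier⇒approximates : ∀ {n} {ε : ℝ} {G H : Graph n} → IsCutSparsifier ε G H → ∀ {η} → 0ℚ ℚ.< η →
  Eventually (λ m → Approximates (seq ε m) η (weights G m) (weights H m))
sparsifier⇒approximates {ε = ε} {G} {H} sparsifier {η} 0<η = eventually-∀Subset λ S →
  eventually-map
    (λ m → subst₂ (λ g h → (1ℚ ℚ.- seq ε m) ℚ.* g ℚ.≤ h ℚ.+ η × h ℚ.≤ (1ℚ ℚ.+ seq ε m) ℚ.* g ℚ.+ η)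
      (seq-cutWeight G S m) (seq-cutWeight H S m))
    (eventually-× (proj₁ (sparsifier S) η 0<η) (proj₂ (sparsifier S) η 0<η))

-- The biclique and its sparsifiers.

Biclique : ∀ s p → Graph (s ℕ.+ p)
Biclique s p = record
  { adj        = λ i j → opposite (splitAt s i) (splitAt s j)
  ; adj-sym    = λ i j → opposite-sym (splitAt s i) (splitAt s j)
  ; adj-irrefl = λ i → opposite-irrefl (splitAt s i)
  ; weight     = λ _ _ → 1ℝ
  ; weight-sym = λ _ _ _ δ 0<δ → 0 , λ _ _ → 0<δ
  ; weight-pos = λ _ _ _ → 1ℚ , ℚ.positive⁻¹ 1ℚ , 0 , λ _ _ → ℚ.≤-refl
  }
  where
  opposite : Fin s ⊎ Fin p → Fin s ⊎ Fin p → Bool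
  opposite (inj₁ _) (inj₁ _) = false
  opposite (inj₁ _) (inj₂ _) = true
  opposite (inj₂ _) (inj₁ _) = true
  opposite (inj₂ _) (inj₂ _) = false
  opposite-sym : ∀ x y → T (opposite x y) → T (opposite y x)
  opposite-sym (inj₁ _) (inj₂ _) t = t
  opposite-sym (inj₂ _) (inj₁ _) t = t
  opposite-irrefl : ∀ x → ¬ T (opposite x x)
  opposite-irrefl (inj₁ _) ()
  opposite-irrefl (inj₂ _) ()

weights-Biclique : ∀ s p m → IsBiclique s p (weights (Biclique s p) m)
weights-Biclique s p m = record { LL≡0 = ll ; LR≡1 = lr ; RL≡1 = rl ; RR≡0 = rr }
  where
  open Bipartition {s} {p} (weights (Biclique s p) m)
  ll : ∀ j j′ → LL j j′ ≡ 0ℚ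
  ll j j′ rewrite Fin.splitAt-↑ˡ s j p | Fin.splitAt-↑ˡ s j′ p = refl
  lr : ∀ j i → LR j i ≡ 1ℚ
  lr j i rewrite Fin.splitAt-↑ˡ s j p | Fin.splitAt-↑ʳ s p i = refl
  rl : ∀ i j → RL i j ≡ 1ℚ
  rl i j rewrite Fin.splitAt-↑ˡ s j p | Fin.splitAt-↑ʳ s p i = refl
  rr : ∀ i i′ → RR i i′ ≡ 0ℚ
  rr i i′ rewrite Fin.splitAt-↑ʳ s p i | Fin.splitAt-↑ʳ s p i′ = refl

0≤weights-Biclique : ∀ s p m i j → 0ℚ ℚ.≤ weights (Biclique s p) m i j
0≤weights-Biclique s p m i j with adj (Biclique s p) i j
... | true  = 0≤ι 1
... | false = ℚ.≤-refl

weights-nonadjacent : ∀ {n} (H : Graph n) m {i j} → ¬ T (adj H i j) → weights H m i j ≡ 0ℚ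
weights-nonadjacent H m {i} {j} ¬adj with adj H i j
... | true  = ⊥-elim (¬adj tt)
... | false = refl

module _ {ε : ℝ} {u θ : ℚ} (0<θ : 0ℚ ℚ.< θ) (ε+θ≤u : Eventually (λ m → seq ε m ℚ.+ θ ℚ.≤ u)) where

  private
    -- Half of the gap between `ε` and `u`, because `few-vanishing` asks for `ε + 2 η ≤ u`.
    η : ℚ
    η = ½ ℚ.* θ

    0<η : 0ℚ ℚ.< η
    0<η = ℚ.*-monoʳ-<-pos ½ 0<θ

    2η≡θ : ι 2 ℚ.* η ≡ θ
    2η≡θ = trans (sym (ℚ.*-assoc (ι 2) ½ θ)) (ℚ.*-identityˡ θ)

  sparsifier-dense : ∀ {s p r} → 1 ℕ.≤ r → s ≡ r ℕ.* r → 1 ℕ.≤ p → ι 4 ℚ.* ι r ℚ.* u ℚ.≤ 1ℚ →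
    (H : Graph (s ℕ.+ p)) → IsCutSparsifier ε (Biclique s p) H → p ℕ.* s ℕ.≤ 2 ℕ.* numEdges H
  sparsifier-dense {s} {p} {r} 1≤r s≡r² 1≤p 4ru≤1 H sparsifier =
    ℕ.+-cancelˡ-≤ (p ℕ.* s) (p ℕ.* s) (2 ℕ.* numEdges H) (begin
      p ℕ.* s ℕ.+ p ℕ.* s                        ≡⟨ cong (p ℕ.* s ℕ.+_) (ℕ.+-identityʳ (p ℕ.* s)) ⟨
      2 ℕ.* (p ℕ.* s)                            ≤⟨ ℕ.*-monoʳ-≤ 2 (pairs≤nonEdges+numEdges {s} H) ⟩
      2 ℕ.* (nonEdges ℕ.+ numEdges H)            ≡⟨ ℕ.*-distribˡ-+ 2 nonEdges (numEdges H) ⟩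
      2 ℕ.* nonEdges ℕ.+ 2 ℕ.* numEdges H        ≤⟨ ℕ.+-monoˡ-≤ (2 ℕ.* numEdges H) few ⟩
      p ℕ.* s ℕ.+ 2 ℕ.* numEdges H               ∎)
    where
    open ℕ.≤-Reasoning
    nonEdges = ℕ-sum (λ i → ℕ-sum (λ j → bit (nonEdge {s} H i j)))
    T-not : ∀ {b} → T (not b) → ¬ T b
    T-not {false} _ ()
    -- A single index is enough: the adjacency of `H`, and with it the number of edges, does not
    -- vary with `m`.
    witness : ∃[ m ] (seq ε m ℚ.+ θ ℚ.≤ u × Approximates (seq ε m) η (weights (Biclique s p) m) (weights H m))
    witness = eventually-witness
      (eventually-× ε+θ≤u (sparsifier⇒approximates {ε = ε} {G = Biclique s p} {H = H} sparsifier {η} 0<η))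
    m = proj₁ witness
    vanish : ∀ i j → T (nonEdge {s} H i j) →
      weights H m (s ↑ʳ i) (j ↑ˡ p) ℚ.+ weights H m (j ↑ˡ p) (s ↑ʳ i) ≡ 0ℚ
    vanish i j t = trans
      (cong₂ ℚ._+_ (weights-nonadjacent H m (T-not t ∘ adj-sym H (s ↑ʳ i) (j ↑ˡ p)))
                   (weights-nonadjacent H m (T-not t)))
      (ℚ.+-identityˡ 0ℚ)
    few : 2 ℕ.* nonEdges ℕ.≤ p ℕ.* s
    few = BicliqueSparsifier.few-vanishing {s} {p} {weights (Biclique s p) m} {weights H m}
      (weights-Biclique s p m) {seq ε m} {η} (proj₂ (proj₂ witness)) {r} {u} 1≤r s≡r² 1≤p (ℚ.<⇒≤ 0<η)
      (subst (λ z → seq ε m ℚ.+ z ℚ.≤ u) (sym 2η≡θ) (proj₁ (proj₂ witness))) 4ru≤1 (nonEdge {s} H) vanish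

-- With `δ` the gap between `ε` and 1, an isolated leaf would give `δ ≤ (1 - x) g ≤ ½ δ` for the cut
-- around it; the slack is set to `½ δ` for this contradiction. Existence of a neighbour is
-- decidable, so the contradiction yields one.
sparsifier-covers : ∀ {ε : ℝ} {p} → ε < 1ℝ → (H : Graph (1 ℕ.+ p)) → IsCutSparsifier ε (Biclique 1 p) H →
  ∀ i → ∃[ j ] T (adj H (1 ↑ʳ i) j)
sparsifier-covers {ε} {p} (δ , 0<δ , ε<1) H sparsifier i = decide (Fin.any? (λ j → T? (adj H (1 ↑ʳ i) j)))
  where
  ½δ : ℚ
  ½δ = ½ ℚ.* δ
  Witness : Set
  Witness = ∃[ m ] (seq ε m ℚ.+ δ ℚ.≤ 1ℚ × Approximates (seq ε m) ½δ (weights (Biclique 1 p) m) (weights H m))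
  witness : Witness
  witness = eventually-witness
    (eventually-× ε<1 (sparsifier⇒approximates {ε = ε} {G = Biclique 1 p} {H = H} sparsifier {½δ} (ℚ.*-monoʳ-<-pos ½ 0<δ)))
  refute : ¬ (∃[ j ] T (adj H (1 ↑ʳ i) j)) → Witness → ⊥
  refute isolated (m , x+δ≤1 , approx) = ℚ.<-irrefl refl (begin-strict
    ½δ
      <⟨ ℚ.*-monoˡ-<-pos δ {{ℚ.positive 0<δ}} {½} {1ℚ} (ℚ.*<* (ℤ.+<+ ℕ.≤-refl)) ⟩
    1ℚ ℚ.* δ
      ≤⟨ ≤-slack ((1ℚ ℚ.- (x ℚ.+ δ)) ℚ.+ (1ℚ ℚ.- x) ℚ.* (g ℚ.- 1ℚ))
           (0≤+ (0≤-diff x+δ≤1) (0≤* (0≤-diff x≤1) (0≤-diff 1≤g)))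
           (solve 3 (λ x δ g → con 1ℚ :* δ :+ ((con 1ℚ :- (x :+ δ)) :+ (con 1ℚ :- x) :* (g :- con 1ℚ))
             := (con 1ℚ :- x) :* g) refl x δ g) ⟩
    (1ℚ ℚ.- x) ℚ.* g
      ≤⟨ proj₁ (approx S) ⟩
    cutValue (weights H m) S ℚ.+ ½δ
      ≡⟨ cong (ℚ._+ ½δ) (cutValue-singleton-zero (weights H m) (1 ↑ʳ i)
           (λ j → weights-nonadjacent H m (λ t → isolated (j , t)))) ⟩
    0ℚ ℚ.+ ½δ
      ≡⟨ ℚ.+-identityˡ ½δ ⟩
    ½δ ∎)
    where
    open ℚ.≤-Reasoning
    open +-*-Solver using (solve; con; _:=_; _:+_; _:*_; _:-_)
    x = seq ε m
    S = singleton (1 ↑ʳ i)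
    g = cutValue (weights (Biclique 1 p) m) S
    x≤1 : x ℚ.≤ 1ℚ
    x≤1 = ℚ.≤-trans (≤-slack δ (ℚ.<⇒≤ 0<δ) refl) x+δ≤1
    1≤g : 1ℚ ℚ.≤ g
    1≤g = ℚ.≤-trans
      (ℚ.≤-reflexive (sym (IsBiclique.RL≡1 (weights-Biclique 1 p m) i zero)))
      (entry≤cutValue-singleton (weights (Biclique 1 p) m) (0≤weights-Biclique 1 p m) {1 ↑ʳ i} {zero} (λ ()))
  decide : Dec (∃[ j ] T (adj H (1 ↑ʳ i) j)) → ∃[ j ] T (adj H (1 ↑ʳ i) j)
  decide (yes neighbour) = neighbour
  decide (no  isolated)  = ⊥-elim (refute isolated witness)

-- Choosing `r` and splitting into cases need decidable comparisons, which a Cauchy real does not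
-- offer. A rational `u` strictly above `ε` but within a factor 2 of it takes its place.
rational-upper-bound : ∀ (ε : ℝ) → 0ℝ < ε → ∃[ u ] ∃[ θ ] 0ℚ ℚ.< θ ×
  Eventually (λ m → 0ℚ ℚ.≤ seq ε m × seq ε m ℚ.+ θ ℚ.≤ u × u ℚ.≤ ι 2 ℚ.* seq ε m)
rational-upper-bound ε (δ , 0<δ , N , δ≤ε) with cauchy ε (½ ℚ.* ½ ℚ.* δ) (ℚ.*-monoʳ-<-pos (½ ℚ.* ½) 0<δ)
-- On the tail `ε` differs from `y`, its value at `K`, by at most `δ/4`. Hence `u = y + δ/2` exceeds
-- it by at least `δ/4`, which is the gap, and by at most `3δ/4`, which is below `ε` since `δ ≤ ε`
-- there.
... | M , close = seq ε K ℚ.+ ½ ℚ.* δ , ½ ℚ.* ½ ℚ.* δ , ℚ.*-monoʳ-<-pos (½ ℚ.* ½) 0<δ , K , λ m K≤m →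
  let x = seq ε m
      y = seq ε K
      z = ½ ℚ.* ½ ℚ.* δ
      δ≤x : δ ℚ.≤ x
      δ≤x = subst (ℚ._≤ x) (ℚ.+-identityˡ δ) (δ≤ε m (ℕ.m⊔n≤o⇒m≤o N M K≤m))
      M≤m = ℕ.m⊔n≤o⇒n≤o N M K≤m
      M≤K = ℕ.m≤n⊔m N M
      x-y≤z : x ℚ.- y ℚ.≤ z
      x-y≤z = ℚ.≤-trans (p≤∣p∣ (x ℚ.- y)) (ℚ.<⇒≤ (close m K M≤m M≤K))
      y-x≤z : y ℚ.- x ℚ.≤ z
      y-x≤z = ℚ.≤-trans (p≤∣p∣ (y ℚ.- x)) (ℚ.<⇒≤ (close K m M≤K M≤m))
  in ℚ.≤-trans (ℚ.<⇒≤ 0<δ) δ≤x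
   , ≤-slack (z ℚ.- (x ℚ.- y)) (0≤-diff x-y≤z)
       (solve 3 (λ x y δ → x :+ con (½ ℚ.* ½) :* δ :+ (con (½ ℚ.* ½) :* δ :- (x :- y)) := y :+ con ½ :* δ) refl x y δ)
   , ≤-slack ((z ℚ.- (y ℚ.- x)) ℚ.+ ((x ℚ.- δ) ℚ.+ z)) (0≤+ (0≤-diff y-x≤z) (0≤+ (0≤-diff δ≤x)
         (ℚ.<⇒≤ (ℚ.*-monoʳ-<-pos (½ ℚ.* ½) 0<δ))))
       (solve 3 (λ x y δ → y :+ con ½ :* δ :+ ((con (½ ℚ.* ½) :* δ :- (y :- x)) :+ ((x :- δ) :+ con (½ ℚ.* ½) :* δ))
          := con (ι 2) :* x) refl x y δ)
  where
  open +-*-Solver using (solve; con; _:=_; _:+_; _:*_; _:-_)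
  K = N ℕ.⊔ M
  p≤∣p∣ : ∀ p → p ℚ.≤ ℚ.∣ p ∣
  p≤∣p∣ p with ℚ.≤-total 0ℚ p
  ... | inj₁ 0≤p = ℚ.≤-reflexive (sym (ℚ.0≤p⇒∣p∣≡p 0≤p))
  ... | inj₂ p≤0 = ℚ.≤-trans p≤0 (ℚ.0≤∣p∣ p)

<-eventually : ∀ {x y : ℝ} → x < y → Eventually (λ m → seq x m ℚ.< seq y m)
<-eventually {x} {y} (δ , 0<δ , N , x+δ≤y) = N , λ m N≤m →
  ℚ.<-≤-trans (subst (ℚ._< seq x m ℚ.+ δ) (ℚ.+-identityʳ (seq x m)) (ℚ.+-monoʳ-< (seq x m) 0<δ)) (x+δ≤y m N≤m)

fromℚ-density : ∀ {ε : ℝ} r n e → Eventually (λ m → 0ℚ ℚ.≤ seq ε m × 1ℚ ℚ.≤ ι 16 ℚ.* ι r ℚ.* seq ε m) →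
  n ℕ.* (r ℕ.* r) ℕ.≤ 4 ℕ.* e → fromℚ c₀ * fromℕ n ≤ fromℕ e * (ε * ε)
fromℚ-density r n e (N , large) nr²≤4e δ 0<δ = N , λ m N≤m →
  ℚ.≤-trans (density-bound r n e (proj₁ (large m N≤m)) (proj₂ (large m N≤m)) nr²≤4e)
    (≤-slack δ (ℚ.<⇒≤ 0<δ) refl)

-- The two ranges of `ε`.

module _ {n : ℕ} {ε : ℝ} (0<ε : 0ℝ < ε) (1<ε²n : 1ℝ < ε * ε * fromℕ n) (ε<1 : ε < 1ℝ) where

  HasDenseSparsifiers : Set
  HasDenseSparsifiers = Σ[ G ∈ Graph n ] (∀ (H : Graph n) → IsCutSparsifier ε G H →
    fromℚ c₀ * fromℕ n ≤ fromℕ (numEdges H) * (ε * ε))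

  -- Since `2 r² ≤ n`, the large side has `p ≥ n/2` vertices, so `p r² / 2` edges are at least
  -- `n r² / 4`.
  biclique-suffices : ∀ r → 2 ℕ.* (r ℕ.* r) ℕ.≤ n →
    Eventually (λ m → 0ℚ ℚ.≤ seq ε m × 1ℚ ℚ.≤ ι 16 ℚ.* ι r ℚ.* seq ε m) →
    (∀ p → r ℕ.* r ℕ.≤ p → (H : Graph (r ℕ.* r ℕ.+ p)) → IsCutSparsifier ε (Biclique (r ℕ.* r) p) H →
      p ℕ.* (r ℕ.* r) ℕ.≤ 2 ℕ.* numEdges H) →
    HasDenseSparsifiers
  biclique-suffices r 2r²≤n large dense =
    subst (λ n → Σ[ G ∈ Graph n ] (∀ (H : Graph n) → IsCutSparsifier ε G H →
        fromℚ c₀ * fromℕ n ≤ fromℕ (numEdges H) * (ε * ε)))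
      (ℕ.m+[n∸m]≡n s≤n)
      (Biclique s p , λ H sparsifier → fromℚ-density {ε} r (s ℕ.+ p) (numEdges H) large (begin
        (s ℕ.+ p) ℕ.* s                      ≤⟨ ℕ.*-monoˡ-≤ s (ℕ.+-monoˡ-≤ p s≤p) ⟩
        (p ℕ.+ p) ℕ.* s                      ≡⟨ ℕ.*-distribʳ-+ s p p ⟩
        p ℕ.* s ℕ.+ p ℕ.* s                  ≤⟨ ℕ.+-mono-≤ (dense p s≤p H sparsifier) (dense p s≤p H sparsifier) ⟩
        2 ℕ.* numEdges H ℕ.+ 2 ℕ.* numEdges H  ≡⟨ ℕ.*-distribʳ-+ (numEdges H) 2 2 ⟨
        4 ℕ.* numEdges H                     ∎))
    where
    open ℕ.≤-Reasoning
    s = r ℕ.* r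
    p = n ℕ.∸ s
    s+s≤n : s ℕ.+ s ℕ.≤ n
    s+s≤n = subst (ℕ._≤ n) (cong (s ℕ.+_) (ℕ.+-identityʳ s)) 2r²≤n
    s≤n : s ℕ.≤ n
    s≤n = ℕ.≤-trans (ℕ.m≤m+n s s) s+s≤n
    s≤p : s ℕ.≤ p
    s≤p = ℕ.m+n≤o⇒m≤o∸n s s+s≤n

  module _ {u θ : ℚ} (0<θ : 0ℚ ℚ.< θ)
    (bounds : Eventually (λ m → 0ℚ ℚ.≤ seq ε m × seq ε m ℚ.+ θ ℚ.≤ u × u ℚ.≤ ι 2 ℚ.* seq ε m))
    {x : ℚ} (0≤x : 0ℚ ℚ.≤ x) (x≤u : x ℚ.≤ u) (x≤1 : x ℚ.≤ 1ℚ) (1<x²n : 1ℚ ℚ.< x ℚ.* x ℚ.* ι n) where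

    open +-*-Solver using (solve; con; _:=_; _:+_; _:*_; _:-_)

    small-ε : (∃[ r ] 1 ℕ.≤ r × ι 4 ℚ.* ι r ℚ.* u ℚ.≤ 1ℚ × 1ℚ ℚ.≤ ι 8 ℚ.* ι r ℚ.* u) → HasDenseSparsifiers
    small-ε (r , 1≤r , 4ru≤1 , 1≤8ru) = biclique-suffices r
      (ℕ.≤-trans (ℕ.*-monoˡ-≤ (r ℕ.* r) (ℕ.m≤m+n 2 14)) (size>16r² {x} {u} r n 0≤x x≤u 1<x²n 4ru≤1))
      (eventually-map (λ { k (0≤y , _ , u≤2y) → 0≤y , scale (seq ε k) u≤2y }) bounds)
      (λ p r²≤p → sparsifier-dense {ε} {u} {θ} 0<θ (eventually-map (λ _ b → proj₁ (proj₂ b)) bounds)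
        {r ℕ.* r} {p} {r} 1≤r refl (ℕ.≤-trans (ℕ.*-mono-≤ 1≤r 1≤r) r²≤p) 4ru≤1)
      where
      scale : ∀ y → u ℚ.≤ ι 2 ℚ.* y → 1ℚ ℚ.≤ ι 16 ℚ.* ι r ℚ.* y
      scale y u≤2y = ℚ.≤-trans 1≤8ru (≤-slack (ι 8 ℚ.* ι r ℚ.* (ι 2 ℚ.* y ℚ.- u))
        (0≤* (0≤* (0≤ι 8) (0≤ι r)) (0≤-diff u≤2y))
        (solve 3 (λ r u y → con (ι 8) :* r :* u :+ con (ι 8) :* r :* (con (ι 2) :* y :- u)
          := con (ι 16) :* r :* y) refl (ι r) u y))

    -- Now `ε` exceeds 1/8 on a tail, so `n/ε²` is only linear in `n` and a star is enough. The
    -- bound is relaxed to 1/16 to share the constant of the other case.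
    large-ε : ¬ (ι 4 ℚ.* ι 1 ℚ.* u ℚ.≤ 1ℚ) → HasDenseSparsifiers
    large-ε 4u≰1 = biclique-suffices 1 (size>1 {x} n 0≤x x≤1 1<x²n)
      (eventually-map (λ { k (0≤y , _ , u≤2y) → 0≤y , scale (seq ε k) 0≤y u≤2y }) bounds)
      (λ p _ H sparsifier → subst (ℕ._≤ 2 ℕ.* numEdges H) (sym (ℕ.*-identityʳ p))
        (covered≤2*numEdges {1} {p} H (sparsifier-covers {ε} {p} ε<1 H sparsifier)))
      where
      scale : ∀ y → 0ℚ ℚ.≤ y → u ℚ.≤ ι 2 ℚ.* y → 1ℚ ℚ.≤ ι 16 ℚ.* ι 1 ℚ.* y
      scale y 0≤y u≤2y = ℚ.≤-trans (ℚ.<⇒≤ (ℚ.≰⇒> 4u≰1))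
        (≤-slack (ι 4 ℚ.* (ι 2 ℚ.* y ℚ.- u) ℚ.+ ι 8 ℚ.* y)
          (0≤+ (0≤* (0≤ι 4) (0≤-diff u≤2y)) (0≤* (0≤ι 8) 0≤y))
          (solve 2 (λ u y → con (ι 4) :* con (ι 1) :* u :+ (con (ι 4) :* (con (ι 2) :* y :- u) :+ con (ι 8) :* y)
            := con (ι 16) :* con (ι 1) :* y) refl u y))

    split-ε : Dec (ι 4 ℚ.* ι 1 ℚ.* u ℚ.≤ 1ℚ) → HasDenseSparsifiers
    split-ε (yes 4u≤1) = small-ε (choose-side {x} {u} n 0≤x x≤1 x≤u 1<x²n 4u≤1)
    split-ε (no  4u≰1) = large-ε 4u≰1

  hasDenseSparsifiers : HasDenseSparsifiers
  hasDenseSparsifiers = assemble (rational-upper-bound ε 0<ε)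
    where
    Bounds : ℚ → ℚ → ℕ → Set
    Bounds u θ m = 0ℚ ℚ.≤ seq ε m × seq ε m ℚ.+ θ ℚ.≤ u × u ℚ.≤ ι 2 ℚ.* seq ε m
    assemble : (∃[ u ] ∃[ θ ] 0ℚ ℚ.< θ × Eventually (Bounds u θ)) → HasDenseSparsifiers
    assemble (u , θ , 0<θ , bounds) = atIndex (eventually-witness (eventually-× bounds
        (eventually-× (<-eventually {1ℝ} {ε * ε * fromℕ n} 1<ε²n) (<-eventually {ε} {1ℝ} ε<1))))
      where
      atIndex : (∃[ m ] Bounds u θ m × 1ℚ ℚ.< seq ε m ℚ.* seq ε m ℚ.* ι n × seq ε m ℚ.< 1ℚ) → HasDenseSparsifiers
      -- One value of the sequence carries `1 < ε² n` and `ε < 1` over to ℚ, where they constrain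
      -- `n` and `r`. The final inequality between reals still rests on `bounds`, which holds on a
      -- tail.
      atIndex (m , (0≤x , x+θ≤u , _) , 1<x²n , x<1) = split-ε {u} {θ} 0<θ bounds {seq ε m} 0≤x
        (ℚ.≤-trans (≤-slack θ (ℚ.<⇒≤ 0<θ) refl) x+θ≤u) (ℚ.<⇒≤ x<1) 1<x²n (ι 4 ℚ.* ι 1 ℚ.* u ℚ.≤? 1ℚ)

theorem3p2 : Σ[ c ∈ ℝ ] (0ℝ < c ×
    (∀ (n : ℕ) (ε : ℝ) →
    0ℝ < ε → 1ℝ < ε * ε * fromℕ n → ε < 1ℝ →
    Σ[ G ∈ Graph n ] (∀ (H : Graph n) → IsCutSparsifier ε G H →
    c * fromℕ n ≤ fromℕ (numEdges H) * (ε * ε))))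
theorem3p2 = fromℚ c₀
  , (c₀ , ℚ.positive⁻¹ c₀ , 0 , λ _ _ → ℚ.≤-reflexive (ℚ.+-identityˡ c₀))
  , λ n ε → hasDenseSparsifiers {n} {ε}
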